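{- Let $h,w$ be positive integers with $h\ge w$. Then \[ e_{max}(h,w)=\begin{cases} hw/3, & \text{if } w=1 \text{ or } h=w=2;\\ hw/12, & \text{if } h\equiv 0 \pmod 2,\ h\ge 4,\ w=2;\\ hw/12+1/2, & \text{if } h\equiv 1\pmod 2,\ h\ge 3,\ w=2;\\ 2, & \text{if } w=3 \text{ or } h\equiv w\equiv 0\pmod 3;\\ 4/3, & \text{if } w\ge 4 \text{ and } h\equiv w\not\equiv 0 \pmod 3;\\ 1, & \text{if } w\ge 4,\ hw\equiv 0\pmod 3 \text{ and } h\not\equiv w \pmod 3;\\ 2/3, & \text{otherwise.}\end{cases} \]
   Context: A 2-dimensional binary word of dimensions $h\times w$ is an $h\times w$ matrix $W$ with entries in $\{\square,\blacksquare\}$ (filled cells $\blacksquare$, empty cells $\square$); $|W|_\blacksquare$ is its number of filled cells. Positions $(i,j),(i',j')$ are adjacent if $|i-i'|+|j-j'|=1$; the degree of a filled cell is the number of filled cells adjacent to it. $\mathcal W^2_{h\times w}$ is the set of $h\times w$ words in which every filled cell has degree at most $2$. The excess of an $h\times w$ word $W$ is $e(W)=|W|_\blacksquare-2hw/3$, and $e_{max}(h,w)=\max\{e(W): W\in\mathcal W^2_{h\times w}\}$. -}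

module Defs where

open import Data.Bool using (Bool; true; false; if_then_else_; _∧_; _∨_; not)
open import Data.Nat using (ℕ; zero; suc; _+_; _*_; _≤_; _%_; _≡ᵇ_; _≤ᵇ_; ∣_-_∣)
open import Data.Fin using (Fin; toℕ) renaming (zero to fzero; suc to fsuc)
open import Data.Integer using (+_)
open import Data.Rational using (ℚ; _/_; _-_) renaming (_+_ to _+ℚ_)
open import Data.Rational using () renaming (_≤_ to _≤ℚ_)
open import Data.Product using (Σ; _×_)
open import Relation.Binary.PropositionalEquality using (_≡_)

sumFin : (n : ℕ) → (Fin n → ℕ) → ℕ
sumFin zero    f = 0
sumFin (suc n) f = f fzero + sumFin n (λ i → f (fsuc i))

-- A 2-dimensional binary word of dimensions h × w; true = filled cell ■.
Word : ℕ → ℕ → Set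
Word h w = Fin h → Fin w → Bool

ind : Bool → ℕ
ind true  = 1
ind false = 0

filledCount : ∀ {h w} → Word h w → ℕ
filledCount {h} {w} W = sumFin h (λ i → sumFin w (λ j → ind (W i j)))

adjacent : ∀ {h w} → Fin h → Fin w → Fin h → Fin w → Bool
adjacent i j i' j' = (∣ toℕ i - toℕ i' ∣ + ∣ toℕ j - toℕ j' ∣) ≡ᵇ 1

degree : ∀ {h w} → Word h w → Fin h → Fin w → ℕ
degree {h} {w} W i j =
  sumFin h (λ i' → sumFin w (λ j' → ind (adjacent i j i' j' ∧ W i' j')))

InW2 : ∀ {h w} → Word h w → Set
InW2 {h} {w} W = ∀ i j → W i j ≡ true → degree W i j ≤ 2

excess : ∀ {h w} → Word h w → ℚ
excess {h} {w} W = (+ filledCount W) / 1 - (+ (2 * h * w)) / 3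

IsEmax : ℕ → ℕ → ℚ → Set
IsEmax h w v =
  Σ (Word h w) (λ W → InW2 W × excess W ≡ v)
  × (∀ (W : Word h w) → InW2 W → excess W ≤ℚ v)

emaxFormula : ℕ → ℕ → ℚ
emaxFormula h w =
  if (w ≡ᵇ 1) ∨ ((h ≡ᵇ 2) ∧ (w ≡ᵇ 2)) then (+ (h * w)) / 3
  else if ((h % 2) ≡ᵇ 0) ∧ (4 ≤ᵇ h) ∧ (w ≡ᵇ 2) then (+ (h * w)) / 12
  else if ((h % 2) ≡ᵇ 1) ∧ (3 ≤ᵇ h) ∧ (w ≡ᵇ 2) then (+ (h * w)) / 12 +ℚ (+ 1) / 2
  else if (w ≡ᵇ 3) ∨ (((h % 3) ≡ᵇ 0) ∧ ((w % 3) ≡ᵇ 0)) then (+ 2) / 1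
  else if (4 ≤ᵇ w) ∧ ((h % 3) ≡ᵇ (w % 3)) ∧ not ((w % 3) ≡ᵇ 0) then (+ 4) / 3
  else if (4 ≤ᵇ w) ∧ (((h * w) % 3) ≡ᵇ 0) ∧ not ((h % 3) ≡ᵇ (w % 3)) then (+ 1) / 1
  else (+ 2) / 3

{-# OPTIONS --safe #-}
-- Write F, E for the numbers of filled and empty cells, so that 3e = F − 2E. Let the penalty of a filled
-- cell be 2 minus its degree, and that of an empty cell its number of empty neighbours. Counting sides of
-- cells gives 2F − 4E = B − P, where B is the number of filled minus the number of empty cells along the
-- border (a corner counting for both of its sides) and P is the total penalty.
--
-- If h, w ≥ 6, drop all penalties outside the three outermost layers and share the remaining ones between
-- the four sides along the diagonals at the corners. Then each side of length n contributes at most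
-- 3, 5/2 or 2 according to n mod 3. This concerns strips of depth three only and is a transfer-matrix
-- computation: the tables of optimal completions become periodic with period 3. Since 2F − 4E ≡ 2hw
-- modulo 6, the resulting bound on 2F − 4E rounds down to the claimed maximum. For 2 ≤ w ≤ 5 the optimal
-- completions row by row are directly periodic.
--
-- For w ≥ 4 an optimal word has its empty cells on the diagonals i ≡ j (mod 3), except that the top left
-- and the bottom right corner are filled.
module Submission where

open import Defs
open import Data.Bool using (Bool; true; false; if_then_else_; _∧_; _∨_; not; T)
open import Data.Bool.Properties using (T-∧; ∧-zeroʳ; ∨-identityʳ)
open import Data.Fin using (Fin; toℕ; fromℕ<) renaming (zero to fzero; suc to fsuc)
open import Data.Fin.Properties using (toℕ-fromℕ<; toℕ<n)
import Data.Integer as ℤ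
import Data.Integer.Properties as ℤₚ
open import Data.Nat hiding (_/_)
open import Data.Nat.DivMod using (%-distribˡ-*; m%n<n; [m+kn]%n≡m%n)
open import Data.Nat.Properties
open import Data.Nat.Tactic.RingSolver using (solve-∀)
open import Data.Product using (Σ; _×_; _,_; proj₁; proj₂)
open import Data.Rational using (ℚ; _/_; _-_; -_; 0ℚ) renaming (_+_ to _+ℚ_; _≤_ to _≤ℚ_)
import Data.Rational.Properties as ℚₚ
open import Data.Rational.Unnormalised using (mkℚᵘ; *≡*; *≤*)
import Data.Rational.Unnormalised.Properties as ℚᵘₚ
open import Data.Sum using (_⊎_; inj₁; inj₂)
open import Data.Unit using (⊤; tt)
open import Data.Vec using (Vec; []; _∷_; replicate)
open import Function.Bundles using (Equivalence)
open import Relation.Binary.PropositionalEquality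

-- Transfer tables for words read column by column

∑ : ℕ → (ℕ → ℕ) → ℕ
∑ zero    f = 0
∑ (suc n) f = f 0 + ∑ n (λ i → f (suc i))

Bits : ℕ → Set
Bits = Vec Bool

-- Values are stored in a trie rather than kept as a function, so that the recursion over the
-- columns looks up entries of the preceding table instead of branching anew at each column.
data Trie (A : Set) : ℕ → Set where
  leaf : A → Trie A zero
  node : ∀ {n} → Trie A n → Trie A n → Trie A (suc n)

memo : ∀ {A : Set} {n} → (Bits n → A) → Trie A n
memo {n = zero}  f = leaf (f [])
memo {n = suc n} f = node (memo (λ v → f (false ∷ v))) (memo (λ v → f (true ∷ v)))

look : ∀ {A : Set} {n} → Trie A n → Bits n → A
look (leaf x)   []          = x
look (node l r) (false ∷ v) = look l v
look (node l r) (true ∷ v)  = look r v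

look-memo : ∀ {A : Set} {n} (f : Bits n → A) v → look (memo f) v ≡ f v
look-memo f []          = refl
look-memo f (false ∷ v) = look-memo (λ v → f (false ∷ v)) v
look-memo f (true ∷ v)  = look-memo (λ v → f (true ∷ v)) v

Table : ℕ → Set
Table d = Trie (Trie ℕ d) d

memo₂ : ∀ {d} → (Bits d → Bits d → ℕ) → Table d
memo₂ f = memo (λ a → memo (f a))

look₂ : ∀ {d} → Table d → Bits d → Bits d → ℕ
look₂ t a b = look (look t a) b

look₂-memo₂ : ∀ {d} (f : Bits d → Bits d → ℕ) a b → look₂ (memo₂ f) a b ≡ f a b
look₂-memo₂ f a b = trans (cong (λ t → look t b) (look-memo (λ a → memo (f a)) a)) (look-memo (f a) b)

allBits : ∀ {d} → (Bits d → Bool) → Bool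
allBits {zero}  p = p []
allBits {suc d} p = allBits (λ v → p (false ∷ v)) ∧ allBits (λ v → p (true ∷ v))

allBits-sound : ∀ {d} (p : Bits d → Bool) → T (allBits p) → ∀ v → T (p v)
allBits-sound p h []          = h
allBits-sound p h (false ∷ v) = allBits-sound _ (proj₁ (Equivalence.to T-∧ h)) v
allBits-sound p h (true ∷ v)  =
  allBits-sound _ (proj₂ (Equivalence.to (T-∧ {allBits (λ v → p (false ∷ v))}) h)) v

fits : Bool → Bool → Bool → Bool → Bool → Bool
fits false _ _ _ _ = true
fits true  p q r s = ind p + ind q + ind r + ind s ≤ᵇ 2

hd : ∀ {n} → Bits n → Bool
hd []      = false
hd (x ∷ _) = x

-- All values are natural numbers, so the value 0 for a forbidden choice never raises a maximum.
guard : Bool → ℕ → ℕ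
guard c x = if c then x else 0

-- The maximum of k over the columns that may follow b when a precedes it;
-- p is the cell just above the head of b.
best : ∀ {n} → Bool → Bits n → Bits n → (Bits n → ℕ) → ℕ
best p []       []       k = k []
best p (a ∷ as) (b ∷ bs) k =
  guard (fits b p (hd bs) a false) (best b as bs (λ cs → k (false ∷ cs))) ⊔′
  guard (fits b p (hd bs) a true)  (best b as bs (λ cs → k (true ∷ cs)))

Legal : ∀ {n} → Bool → Bits n → Bits n → Bits n → Set
Legal p []       []       []       = ⊤
Legal p (a ∷ as) (b ∷ bs) (c ∷ cs) = fits b p (hd bs) a c ≡ true × Legal b as bs cs

guard-≥ : ∀ {c m x} → c ≡ true → m ≤ x → m ≤ guard c x
guard-≥ refl m≤x = m≤x

guard-mono : ∀ c {x y} e → x ≤ y + e → guard c x ≤ guard c y + e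
guard-mono false e h = z≤n
guard-mono true  e h = h

-- `_⊔′_` compares with the built-in `_<ᵇ_`, which keeps the evaluation of the tables fast; its
-- order properties are transferred from `_⊔_`.
m≤m⊔′n : ∀ m n → m ≤ m ⊔′ n
m≤m⊔′n m n = subst (m ≤_) (⊔≡⊔′ m n) (m≤m⊔n m n)

n≤m⊔′n : ∀ m n → n ≤ m ⊔′ n
n≤m⊔′n m n = subst (n ≤_) (⊔≡⊔′ m n) (m≤n⊔m m n)

⊔′-mono : ∀ {m n m′ n′} e → m ≤ m′ + e → n ≤ n′ + e → m ⊔′ n ≤ (m′ ⊔′ n′) + e
⊔′-mono {m} {n} {m′} {n′} e h h′ = subst (_≤ (m′ ⊔′ n′) + e) (⊔≡⊔′ m n)
  (⊔-lub (≤-trans h (+-monoˡ-≤ e (m≤m⊔′n m′ n′))) (≤-trans h′ (+-monoˡ-≤ e (n≤m⊔′n m′ n′))))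

best-upper : ∀ {n} p (as bs cs : Bits n) (k : Bits n → ℕ) → Legal p as bs cs → k cs ≤ best p as bs k
best-upper p []       []       []           k _       = ≤-refl
best-upper p (a ∷ as) (b ∷ bs) (false ∷ cs) k (f , l) =
  ≤-trans (guard-≥ f (best-upper b as bs cs (λ cs → k (false ∷ cs)) l))
          (m≤m⊔′n _ (guard (fits b p (hd bs) a true) (best b as bs (λ cs → k (true ∷ cs)))))
best-upper p (a ∷ as) (b ∷ bs) (true ∷ cs)  k (f , l) =
  ≤-trans (guard-≥ f (best-upper b as bs cs (λ cs → k (true ∷ cs)) l))
          (n≤m⊔′n (guard (fits b p (hd bs) a false) (best b as bs (λ cs → k (false ∷ cs)))) _)

-- Adding a constant commutes with maxima, up to the default 0, where 0 ≤ 0 + e suffices. This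
-- carries a comparison of two tables over to the column before.
best-mono : ∀ {n} p (as bs : Bits n) {k k′ : Bits n → ℕ} e →
            (∀ cs → k cs ≤ k′ cs + e) → best p as bs k ≤ best p as bs k′ + e
best-mono p []       []       e h = h []
best-mono p (a ∷ as) (b ∷ bs) e h =
  ⊔′-mono e (guard-mono (fits b p (hd bs) a false) e (best-mono b as bs e (λ cs → h (false ∷ cs))))
            (guard-mono (fits b p (hd bs) a true)  e (best-mono b as bs e (λ cs → h (true ∷ cs))))

blank : ∀ {d} → Bits d
blank = replicate _ false

next : ℕ → ℕ
next 0 = 1
next 1 = 2
next _ = 3

-- min j 3: the columns of a strip look alike from the fourth on.
clip : ℕ → ℕ
clip zero    = 0
clip (suc j) = next (clip j)

_≤ᵗ_+_ : ∀ {d} → Table d → Table d → ℕ → Bool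
t ≤ᵗ u + c = allBits (λ a → allBits (λ b → look₂ t a b ≤ᵇ look₂ u a b + c))

_≤ᵛ_ : ∀ {d} → Table d → ℕ → Bool
t ≤ᵛ c = allBits (λ b → look₂ t blank b ≤ᵇ c)

-- In `val k n a b c` the column b stands between a and c, with k columns of the word before it (up
-- to `clip`) and n after it. `value k n a b` bounds the total over n columns, the first of which is
-- b, when a precedes them.
module Chain {d : ℕ} (val : ℕ → ℕ → Bits d → Bits d → Bits d → ℕ) where

  table : ℕ → ℕ → Table d
  -- Here b lies beyond the end of the word. It is not forced to be blank, which can only raise the
  -- maximum and so keeps it an upper bound.
  table k zero    = memo₂ (λ _ _ → 0)
  table k (suc n) = extend (table (next k) n)
    where
    extend : Table d → Table d
    extend t = memo₂ (λ a b → best false a b (λ c → val k n a b c + look₂ t b c))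

  -- Opaque, so that comparing two values never unfolds their tables.
  opaque
    value : ℕ → ℕ → Bits d → Bits d → ℕ
    value k n = look₂ (table k n)

    value-suc : ∀ k n a b →
      value k (suc n) a b ≡ best false a b (λ c → val k n a b c + value (next k) n b c)
    value-suc k n = look₂-memo₂ _

    value-≤ : ∀ k n n′ c → (table k n ≤ᵗ table k n′ + c) ≡ true → ∀ a b → value k n a b ≤ value k n′ a b + c
    value-≤ k n n′ c h a b = ≤ᵇ⇒≤ _ _ (allBits-sound _ (allBits-sound _ (subst T (sym h) tt) a) b)

    value-blank-≤ : ∀ k n c → (table k n ≤ᵛ c) ≡ true → ∀ b → value k n blank b ≤ c
    value-blank-≤ k n c h b = ≤ᵇ⇒≤ _ _ (allBits-sound _ (subst T (sym h) tt) b)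

  -- The actual columns are among those over which `best` maximises. Whatever `val` subtracts from
  -- the gain of a column reappears as its loss on the right; j is the number of columns before the
  -- first one.
  value-upper : ∀ n j (x : ℕ → Bits d) (gain loss : ℕ → ℕ) →
    (∀ i → i < n → Legal false (x i) (x (1 + i)) (x (2 + i))) →
    (∀ i m → i + suc m ≡ n → gain i ≤ val (clip (i + j)) m (x i) (x (1 + i)) (x (2 + i)) + loss i) →
    ∑ n gain ≤ value (clip j) n (x 0) (x 1) + ∑ n loss
  value-upper zero    j x gain loss legal bound = z≤n
  value-upper (suc n) j x gain loss legal bound = begin
    gain 0 + ∑ n (λ i → gain (suc i))
      ≤⟨ +-mono-≤ (bound 0 n refl) rest ⟩
    (v + loss 0) + (r + ls)
      ≡⟨ +-assoc v (loss 0) _ ⟩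
    v + (loss 0 + (r + ls))
      ≡⟨ cong (v +_) (trans (sym (+-assoc (loss 0) r ls)) (trans (cong (_+ ls) (+-comm (loss 0) r)) (+-assoc r (loss 0) ls))) ⟩
    v + (r + (loss 0 + ls))
      ≡⟨ sym (+-assoc v r _) ⟩
    (v + r) + (loss 0 + ls)
      ≤⟨ +-monoˡ-≤ _ (best-upper false (x 0) (x 1) (x 2) _ (legal 0 (s≤s z≤n))) ⟩
    best false (x 0) (x 1) (λ c → val (clip j) n (x 0) (x 1) c + value (next (clip j)) n (x 1) c) + (loss 0 + ls)
      ≡⟨ cong (_+ (loss 0 + ls)) (sym (value-suc (clip j) n (x 0) (x 1))) ⟩
    value (clip j) (suc n) (x 0) (x 1) + (loss 0 + ls) ∎
    where
    open ≤-Reasoning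
    v r ls : ℕ
    v  = val (clip j) n (x 0) (x 1) (x 2)
    r  = value (clip (suc j)) n (x 1) (x 2)
    ls = ∑ n (λ i → loss (suc i))
    rest : ∑ n (λ i → gain (suc i)) ≤ r + ls
    rest = value-upper n (suc j) (λ i → x (suc i)) (λ i → gain (suc i)) (λ i → loss (suc i))
      (λ i i<n → legal (suc i) (s≤s i<n))
      (λ i m eq → subst (λ k → gain (suc i) ≤ val (clip k) m (x (1 + i)) (x (2 + i)) (x (3 + i)) + loss (suc i))
                        (sym (+-suc i j)) (bound (suc i) m (cong suc eq)))

  -- Prepending the same column to both lengths preserves the comparison. Thus one finite check of
  -- two tables yields periodicity for all greater lengths.
  value-step : ∀ k {n n′} c → (∀ a b c → val k n a b c ≡ val k n′ a b c) →
    (∀ a b → value (next k) n a b ≤ value (next k) n′ a b + c) →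
    ∀ a b → value k (suc n) a b ≤ value k (suc n′) a b + c
  value-step k {n} {n′} c same h a b =
    subst₂ (λ s t → s ≤ t + c) (sym (value-suc k n a b)) (sym (value-suc k n′ a b))
      (best-mono false a b c λ z → subst (λ u → u + value (next k) n b z ≤ val k n′ a b z + value (next k) n′ b z + c)
        (sym (same a b z))
        (≤-trans (+-monoʳ-≤ (val k n′ a b z) (h b z)) (≤-reflexive (sym (+-assoc (val k n′ a b z) _ c)))))

-- Grids and the penalty identity

∑-mono : ∀ n {f g : ℕ → ℕ} → (∀ i → i < n → f i ≤ g i) → ∑ n f ≤ ∑ n g
∑-mono zero    h = z≤n
∑-mono (suc n) h = +-mono-≤ (h 0 (s≤s z≤n)) (∑-mono n (λ i i<n → h (suc i) (s≤s i<n)))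

∑-cong : ∀ n {f g : ℕ → ℕ} → (∀ i → i < n → f i ≡ g i) → ∑ n f ≡ ∑ n g
∑-cong zero    h = refl
∑-cong (suc n) h = cong₂ _+_ (h 0 (s≤s z≤n)) (∑-cong n (λ i i<n → h (suc i) (s≤s i<n)))

∑-+ : ∀ n (f g : ℕ → ℕ) → ∑ n (λ i → f i + g i) ≡ ∑ n f + ∑ n g
∑-+ zero    f g = refl
∑-+ (suc n) f g = trans (cong (f 0 + g 0 +_) (∑-+ n _ _)) (lemma (f 0) (g 0) _ _)
  where
  lemma : ∀ a b c d → a + b + (c + d) ≡ a + c + (b + d)
  lemma = solve-∀

∑-* : ∀ n c (f : ℕ → ℕ) → ∑ n (λ i → c * f i) ≡ c * ∑ n f
∑-* zero    c f = sym (*-zeroʳ c)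
∑-* (suc n) c f = trans (cong (c * f 0 +_) (∑-* n c _)) (sym (*-distribˡ-+ c (f 0) _))

∑-const : ∀ n c → ∑ n (λ _ → c) ≡ n * c
∑-const zero    c = refl
∑-const (suc n) c = cong (c +_) (∑-const n c)

∑-zero : ∀ n {f : ℕ → ℕ} → (∀ i → i < n → f i ≡ 0) → ∑ n f ≡ 0
∑-zero n h = trans (∑-cong n h) (trans (∑-const n 0) (*-zeroʳ n))

∑-swap : ∀ m n (f : ℕ → ℕ → ℕ) → ∑ m (λ i → ∑ n (f i)) ≡ ∑ n (λ j → ∑ m (λ i → f i j))
∑-swap zero    n f = sym (∑-zero n (λ _ _ → refl))
∑-swap (suc m) n f = trans (cong (∑ n (f 0) +_) (∑-swap m n (λ i → f (suc i)))) (sym (∑-+ n (f 0) _))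

∑-last : ∀ n (f : ℕ → ℕ) → ∑ (suc n) f ≡ ∑ n f + f n
∑-last zero    f = +-comm (f 0) 0
∑-last (suc n) f = trans (cong (f 0 +_) (∑-last n (λ i → f (suc i)))) (sym (+-assoc (f 0) _ _))

∑-rev : ∀ n (f : ℕ → ℕ) → ∑ n f ≡ ∑ n (λ i → f (n ∸ suc i))
∑-rev zero    f = refl
∑-rev (suc n) f = trans (∑-last n f) (trans (+-comm _ (f n)) (cong (f n +_) (∑-rev n f)))

∑∑-+ : ∀ m n (f g : ℕ → ℕ → ℕ) →
  ∑ m (λ i → ∑ n (λ j → f i j + g i j)) ≡ ∑ m (λ i → ∑ n (f i)) + ∑ m (λ i → ∑ n (g i))
∑∑-+ m n f g = trans (∑-cong m (λ i _ → ∑-+ n (f i) (g i))) (∑-+ m _ _)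

data Cell : Set where
  out empty full : Cell

fl em : Cell → ℕ
fl full  = 1
fl _     = 0
em empty = 1
em _     = 0

pen : Cell → Cell → Cell → Cell → Cell → ℕ
pen out   _ _ _ _ = 0
pen empty u d l r = em u + em d + em l + em r
pen full  u d l r = 2 ∸ (fl u + fl d + fl l + fl r)

-- A word surrounded by a ring of outer cells; the cell (i , j) of the word is at (suc i , suc j).
record Grid (h w : ℕ) : Set where
  field
    at     : ℕ → ℕ → Cell
    top    : ∀ j → at 0 j ≡ out
    bottom : ∀ j → at (suc h) j ≡ out
    left   : ∀ i → at i 0 ≡ out
    right  : ∀ i → at i (suc w) ≡ out
    inside : ∀ i j → i < h → j < w → fl (at (suc i) (suc j)) + em (at (suc i) (suc j)) ≡ 1
    degree≤2 : ∀ i j → i < h → j < w → at (suc i) (suc j) ≡ full →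
      fl (at i (suc j)) + fl (at (2 + i) (suc j)) + fl (at (suc i) j) + fl (at (suc i) (2 + j)) ≤ 2

  penalty : ℕ → ℕ → ℕ
  penalty i j = pen (at (suc i) (suc j)) (at i (suc j)) (at (2 + i) (suc j)) (at (suc i) j) (at (suc i) (2 + j))

  filled : ℕ
  filled = ∑ h (λ i → ∑ w (λ j → fl (at (suc i) (suc j))))

open Grid

transpose : ∀ {h w} → Grid h w → Grid w h
transpose G = record
  { at = λ i j → at G j i
  ; top = left G ; bottom = right G ; left = top G ; right = bottom G
  ; inside = λ i j i< j< → inside G j i j< i<
  ; degree≤2 = λ i j i< j< eq → subst (_≤ 2)
      (lemma (fl (at G j (suc i))) (fl (at G (2 + j) (suc i))) (fl (at G (suc j) i)) (fl (at G (suc j) (2 + i))))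
      (degree≤2 G j i j< i< eq)
  }
  where
  lemma : ∀ a b c d → a + b + c + d ≡ c + d + a + b
  lemma = solve-∀

-- With i′ = h - 1 - i, the reflection of the padded rows sends i, 1 + i, 2 + i to 2 + i′, 1 + i′,
-- i′; the first two equations need a proof, the third holds by computation.
module _ {h i : ℕ} (i<h : i < h) where
  flip₁ : h ∸ i ≡ suc (h ∸ suc i)
  flip₁ = +-∸-assoc 1 i<h
  flip₂ : suc h ∸ i ≡ 2 + (h ∸ suc i)
  flip₂ = trans (+-∸-assoc 1 (<⇒≤ i<h)) (cong suc flip₁)
  flip< : h ∸ suc i < h
  flip< = ∸-monoʳ-< (s≤s z≤n) i<h

flip : ∀ {h w} → Grid h w → Grid h w
flip {h} {w} G = record
  { at = λ i j → at G (suc h ∸ i) j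
  ; top = bottom G
  ; bottom = λ j → trans (cong (λ i → at G i j) (n∸n≡0 h)) (top G j)
  ; left = λ i → left G (suc h ∸ i) ; right = λ i → right G (suc h ∸ i)
  ; inside = λ i j i< j< → subst (λ k → fl (at G k (suc j)) + em (at G k (suc j)) ≡ 1)
      (sym (flip₁ i<)) (inside G (h ∸ suc i) j (flip< i<) j<)
  ; degree≤2 = λ i j i< j< eq →
      let i′ = h ∸ suc i in subst (_≤ 2)
        (trans (lemma (fl (at G i′ (suc j))) (fl (at G (2 + i′) (suc j))) (fl (at G (suc i′) j)) (fl (at G (suc i′) (2 + j))))
          (cong₂ (λ p q → fl (at G p (suc j)) + fl (at G i′ (suc j)) + fl (at G q j) + fl (at G q (2 + j)))
            (sym (flip₂ i<)) (sym (flip₁ i<))))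
        (degree≤2 G i′ j (flip< i<) j< (trans (cong (λ k → at G k (suc j)) (sym (flip₁ i<))) eq))
  }
  where
  lemma : ∀ a b c d → a + b + c + d ≡ b + a + c + d
  lemma = solve-∀

pen-swap : ∀ x u d l r → pen x u d l r ≡ pen x d u l r
pen-swap out   u d l r = refl
pen-swap empty u d l r = cong (λ s → s + em l + em r) (+-comm (em u) (em d))
pen-swap full  u d l r = cong (λ s → 2 ∸ (s + fl l + fl r)) (+-comm (fl u) (fl d))

pen-transpose : ∀ x u d l r → pen x u d l r ≡ pen x l r u d
pen-transpose out   u d l r = refl
pen-transpose empty u d l r = lemma (em u) (em d) (em l) (em r)
  where
  lemma : ∀ a b c d → a + b + c + d ≡ c + d + a + b
  lemma = solve-∀
pen-transpose full  u d l r = cong (2 ∸_) (lemma (fl u) (fl d) (fl l) (fl r))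
  where
  lemma : ∀ a b c d → a + b + c + d ≡ c + d + a + b
  lemma = solve-∀

penalty-transpose : ∀ {h w} (G : Grid h w) i j → penalty (transpose G) j i ≡ penalty G i j
penalty-transpose G i j = sym (pen-transpose (at G (suc i) (suc j)) _ _ _ _)

penalty-flip : ∀ {h w} (G : Grid h w) {i} j → i < h → penalty (flip G) i j ≡ penalty G (h ∸ suc i) j
penalty-flip {h} G {i} j i<h = trans
  (cong₂ (λ p q → pen (at G q (suc j)) (at G p (suc j)) (at G (h ∸ suc i) (suc j)) (at G q j) (at G q (2 + j)))
    (flip₂ i<h) (flip₁ i<h))
  (pen-swap (at G (suc (h ∸ suc i)) (suc j)) _ _ _ _)

-- Along a line x₁ … xₙ of bits with complements y: xⱼxⱼ₊₁ − yⱼyⱼ₊₁ = xⱼ − yⱼ₊₁ = xⱼ₊₁ − yⱼ, summed over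
-- the edges of the line; the subtractions are moved to the other side.
module Line (n : ℕ) (x y : ℕ → ℕ) (x₀ : x 0 ≡ 0) (y₀ : y 0 ≡ 0)
            (xₙ : x (2 + n) ≡ 0) (yₙ : y (2 + n) ≡ 0)
            (xy : ∀ j → j < suc n → x (suc j) + y (suc j) ≡ 1) where

  bits : ∀ a b c d → a + b ≡ 1 → c + d ≡ 1 → a * c + d ≡ b * d + a × a * c + b ≡ b * d + c
  bits 0 b 0 d refl refl = refl , refl
  bits 0 b 1 d refl refl = refl , refl
  bits 1 b 0 d refl refl = refl , refl
  bits 1 b 1 d refl refl = refl , refl
  bits 0 b (suc (suc c)) d p ()
  bits 1 b (suc (suc c)) d p ()
  bits (suc (suc a)) b c d () q

  X Y : ℕ
  X = ∑ (suc n) (λ j → x (suc j))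
  Y = ∑ (suc n) (λ j → y (suc j))

  XX YY : ℕ
  XX = ∑ n (λ j → x (1 + j) * x (2 + j))
  YY = ∑ n (λ j → y (1 + j) * y (2 + j))

  Xtail Xinit Ytail Yinit : ℕ
  Xtail = ∑ n (λ j → x (2 + j))
  Xinit = ∑ n (λ j → x (1 + j))
  Ytail = ∑ n (λ j → y (2 + j))
  Yinit = ∑ n (λ j → y (1 + j))

  edges₁ : XX + Ytail ≡ YY + Xinit
  edges₁ = trans (sym (∑-+ n _ _)) (trans (∑-cong n (λ j j<n →
      proj₁ (bits (x (1 + j)) (y (1 + j)) (x (2 + j)) (y (2 + j)) (xy j (m<n⇒m<1+n j<n)) (xy (suc j) (s≤s j<n)))))
    (∑-+ n _ _))

  edges₂ : XX + Yinit ≡ YY + Xtail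
  edges₂ = trans (sym (∑-+ n _ _)) (trans (∑-cong n (λ j j<n →
      proj₂ (bits (x (1 + j)) (y (1 + j)) (x (2 + j)) (y (2 + j)) (xy j (m<n⇒m<1+n j<n)) (xy (suc j) (s≤s j<n)))))
    (∑-+ n _ _))

  -- Each edge is counted from both of its ends, and the terms that leave the line vanish.
  pairs : ∀ (z : ℕ → ℕ) → z 0 ≡ 0 → z (2 + n) ≡ 0 →
    ∑ (suc n) (λ j → z (suc j) * (z j + z (2 + j))) ≡ 2 * ∑ n (λ j → z (1 + j) * z (2 + j))
  pairs z z₀ zₙ = begin
    ∑ (suc n) (λ j → z (suc j) * (z j + z (2 + j)))
      ≡⟨ ∑-cong (suc n) (λ j _ → *-distribˡ-+ (z (suc j)) (z j) (z (2 + j))) ⟩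
    ∑ (suc n) (λ j → z (suc j) * z j + z (suc j) * z (2 + j))
      ≡⟨ ∑-+ (suc n) (λ j → z (suc j) * z j) (λ j → z (suc j) * z (2 + j)) ⟩
    z 1 * z 0 + ∑ n (λ j → z (2 + j) * z (1 + j)) + ∑ (suc n) (λ j → z (suc j) * z (2 + j))
      ≡⟨ cong₂ (λ p q → p + ∑ n (λ j → z (2 + j) * z (1 + j)) + q)
           (trans (cong (z 1 *_) z₀) (*-zeroʳ (z 1)))
           (trans (∑-last n _) (trans (cong (λ p → ∑ n (λ j → z (suc j) * z (2 + j)) + z (suc n) * p) zₙ)
             (trans (cong (∑ n (λ j → z (suc j) * z (2 + j)) +_) (*-zeroʳ (z (suc n)))) (+-identityʳ _)))) ⟩
    ∑ n (λ j → z (2 + j) * z (1 + j)) + ∑ n (λ j → z (1 + j) * z (2 + j))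
      ≡⟨ cong₂ _+_ (∑-cong n (λ j _ → *-comm (z (2 + j)) (z (1 + j)))) (sym (+-identityʳ _)) ⟩
    2 * ∑ n (λ j → z (1 + j) * z (2 + j)) ∎
    where open ≡-Reasoning

  -- The sum of `edges₁` and `edges₂`, with the four partial sums completed to `X` and `Y` by an end
  -- cell each. The constant 2 comes from x + y = 1 at the two ends.
  line : ∑ (suc n) (λ j → x (suc j) * (x j + x (2 + j))) + 2 * Y + 2 * (x 1 + x (suc n))
       ≡ ∑ (suc n) (λ j → y (suc j) * (y j + y (2 + j))) + 2 * X + 2
  line = trans (cong (λ p → p + 2 * Y + 2 * (x 1 + x (suc n))) (pairs x x₀ xₙ))
    (trans (arith XX YY Xtail Xinit Ytail Yinit (x 1) (y 1) (x (suc n)) (y (suc n)) X Y edges₁ edges₂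
       refl refl (∑-last n _) (∑-last n _) (xy 0 (s≤s z≤n)) (xy n ≤-refl))
      (cong (λ p → p + 2 * X + 2) (sym (pairs y y₀ yₙ))))
    where
    arith : ∀ A B xt xi yt yi x₁ y₁ xₗ yₗ X Y → A + yt ≡ B + xi → A + yi ≡ B + xt →
      X ≡ x₁ + xt → Y ≡ y₁ + yt → X ≡ xi + xₗ → Y ≡ yi + yₗ → x₁ + y₁ ≡ 1 → xₗ + yₗ ≡ 1 →
      2 * A + 2 * Y + 2 * (x₁ + xₗ) ≡ 2 * B + 2 * X + 2
    arith A B xt xi yt yi x₁ y₁ xₗ yₗ X Y p q a b c d e f = begin
      2 * A + 2 * Y + 2 * (x₁ + xₗ) ≡⟨ l₁ A Y x₁ xₗ ⟩
      (2 * A + (Y + Y)) + 2 * (x₁ + xₗ) ≡⟨ cong₂ (λ s t → (2 * A + (s + t)) + 2 * (x₁ + xₗ)) b d ⟩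
      (2 * A + (y₁ + yt + (yi + yₗ))) + 2 * (x₁ + xₗ) ≡⟨ l₂ A yt yi x₁ y₁ xₗ yₗ ⟩
      (A + yt) + (A + yi) + (x₁ + y₁) + (xₗ + yₗ) + (x₁ + xₗ) ≡⟨ cong₂ (λ s t → s + t + (x₁ + y₁) + (xₗ + yₗ) + (x₁ + xₗ)) p q ⟩
      (B + xi) + (B + xt) + (x₁ + y₁) + (xₗ + yₗ) + (x₁ + xₗ) ≡⟨ cong₂ (λ s t → (B + xi) + (B + xt) + s + t + (x₁ + xₗ)) e f ⟩
      (B + xi) + (B + xt) + 1 + 1 + (x₁ + xₗ) ≡⟨ l₃ B xi xt x₁ xₗ ⟩
      2 * B + ((x₁ + xt) + (xi + xₗ)) + 2 ≡⟨ cong₂ (λ s t → 2 * B + (s + t) + 2) (sym a) (sym c) ⟩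
      2 * B + (X + X) + 2 ≡⟨ l₄ B X ⟩
      2 * B + 2 * X + 2 ∎
      where
      open ≡-Reasoning
      l₁ : ∀ A Y x₁ xₗ → 2 * A + 2 * Y + 2 * (x₁ + xₗ) ≡ (2 * A + (Y + Y)) + 2 * (x₁ + xₗ)
      l₁ = solve-∀
      l₂ : ∀ A yt yi x₁ y₁ xₗ yₗ → (2 * A + (y₁ + yt + (yi + yₗ))) + 2 * (x₁ + xₗ)
           ≡ (A + yt) + (A + yi) + (x₁ + y₁) + (xₗ + yₗ) + (x₁ + xₗ)
      l₂ = solve-∀
      l₃ : ∀ B xi xt x₁ xₗ → (B + xi) + (B + xt) + 1 + 1 + (x₁ + xₗ) ≡ 2 * B + ((x₁ + xt) + (xi + xₗ)) + 2
      l₃ = solve-∀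
      l₄ : ∀ B X → 2 * B + (X + X) + 2 ≡ 2 * B + 2 * X + 2
      l₄ = solve-∀

empties : ∀ {h w} → Grid h w → ℕ
empties {h} {w} G = ∑ h (λ i → ∑ w (λ j → em (at G (suc i) (suc j))))

penalties : ∀ {h w} → Grid h w → ℕ
penalties {h} {w} G = ∑ h (λ i → ∑ w (penalty G i))

topFilled : ∀ {h w} → Grid h w → ℕ
topFilled {h} {w} G = ∑ w (λ j → fl (at G 1 (suc j)))

filled-transpose : ∀ {h w} (G : Grid h w) → filled (transpose G) ≡ filled G
filled-transpose {h} {w} G = ∑-swap w h _

empties-transpose : ∀ {h w} (G : Grid h w) → empties (transpose G) ≡ empties G
empties-transpose {h} {w} G = ∑-swap w h _

filled+empties : ∀ {h w} (G : Grid h w) → filled G + empties G ≡ h * w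
filled+empties {h} {w} G = trans (sym (∑∑-+ h w _ _))
  (trans (∑-cong h (λ i i<h → trans (∑-cong w (λ j j<w → inside G i j i<h j<w))
                                    (trans (∑-const w 1) (*-identityʳ w))))
         (∑-const h w))

rowPairs : ∀ {h w} → (Cell → ℕ) → Grid h w → ℕ
rowPairs {h} {w} φ G =
  ∑ h (λ i → ∑ w (λ j → φ (at G (suc i) (suc j)) * (φ (at G (suc i) j) + φ (at G (suc i) (2 + j)))))

-- `Line.line` summed over the rows. Here `topFilled` of `transpose G` and of `flip (transpose G)`
-- count the filled cells of the left and the right border column.
row-balance : ∀ {h w} (G : Grid (suc h) (suc w)) →
  rowPairs fl G + 2 * empties G + 2 * (topFilled (transpose G) + topFilled (flip (transpose G)))
    ≡ rowPairs em G + 2 * filled G + 2 * suc h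
row-balance {h} {w} G = begin
  rowPairs fl G + 2 * empties G + 2 * (topFilled (transpose G) + topFilled (flip (transpose G)))
    ≡⟨ cong₂ (λ p q → rowPairs fl G + p + q) (sym (∑-* (suc h) 2 E))
         (trans (cong (2 *_) (sym (∑-+ (suc h) (λ i → x i 1) (λ i → x i (suc w)))))
                (sym (∑-* (suc h) 2 (λ i → x i 1 + x i (suc w))))) ⟩
  rowPairs fl G + ∑ (suc h) (λ i → 2 * E i) + ∑ (suc h) (λ i → 2 * (x i 1 + x i (suc w)))
    ≡⟨ cong (_+ ∑ (suc h) (λ i → 2 * (x i 1 + x i (suc w)))) (sym (∑-+ (suc h) (PX fl) (λ i → 2 * E i))) ⟩
  ∑ (suc h) (λ i → PX fl i + 2 * E i) + ∑ (suc h) (λ i → 2 * (x i 1 + x i (suc w)))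
    ≡⟨ sym (∑-+ (suc h) (λ i → PX fl i + 2 * E i) (λ i → 2 * (x i 1 + x i (suc w)))) ⟩
  ∑ (suc h) (λ i → PX fl i + 2 * E i + 2 * (x i 1 + x i (suc w)))
    ≡⟨ ∑-cong (suc h) (λ i i<h → Line.line w (x i) (λ j → em (at G (suc i) j))
         (cong fl (left G (suc i))) (cong em (left G (suc i)))
         (cong fl (right G (suc i))) (cong em (right G (suc i))) (λ j j<w → inside G i j i<h j<w)) ⟩
  ∑ (suc h) (λ i → PX em i + 2 * F i + 2)
    ≡⟨ trans (∑-+ (suc h) (λ i → PX em i + 2 * F i) (λ _ → 2)) (cong₂ _+_ (∑-+ (suc h) (PX em) (λ i → 2 * F i)) (trans (∑-const (suc h) 2) (*-comm (suc h) 2))) ⟩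
  rowPairs em G + ∑ (suc h) (λ i → 2 * F i) + 2 * suc h
    ≡⟨ cong (λ p → rowPairs em G + p + 2 * suc h) (∑-* (suc h) 2 F) ⟩
  rowPairs em G + 2 * filled G + 2 * suc h ∎
  where
  open ≡-Reasoning
  x : ℕ → ℕ → ℕ
  x i j = fl (at G (suc i) j)
  F E : ℕ → ℕ
  F i = ∑ (suc w) (λ j → fl (at G (suc i) (suc j)))
  E i = ∑ (suc w) (λ j → em (at G (suc i) (suc j)))
  PX : (Cell → ℕ) → ℕ → ℕ
  PX φ i = ∑ (suc w) (λ j → φ (at G (suc i) (suc j)) * (φ (at G (suc i) j) + φ (at G (suc i) (2 + j))))

-- The definition of the penalty, with the neighbours grouped into a vertical and a horizontal pair.
-- The degree bound makes the truncated subtraction in `pen` exact.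
pen-charge : ∀ x u d l r → fl x + em x ≡ 1 → (x ≡ full → fl u + fl d + fl l + fl r ≤ 2) →
  pen x u d l r + (fl x * (fl u + fl d) + fl x * (fl l + fl r))
    ≡ 2 * fl x + (em x * (em u + em d) + em x * (em l + em r))
pen-charge empty u d l r _ _ = lemma (em u) (em d) (em l) (em r)
  where
  lemma : ∀ a b c d → a + b + c + d + 0 ≡ 0 + (a + b + 0 + (c + d + 0))
  lemma = solve-∀
pen-charge full u d l r _ deg = trans (cong ((2 ∸ s) +_) (lemma (fl u) (fl d) (fl l) (fl r))) (m∸n+n≡m (deg refl))
  where
  s : ℕ
  s = fl u + fl d + fl l + fl r
  lemma : ∀ a b c d → a + b + 0 + (c + d + 0) ≡ a + b + c + d
  lemma = solve-∀

pen-balance : ∀ {h w} (G : Grid h w) →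
  penalties G + (rowPairs fl (transpose G) + rowPairs fl G)
    ≡ 2 * filled G + (rowPairs em (transpose G) + rowPairs em G)
pen-balance {h} {w} G = begin
  penalties G + (rowPairs fl (transpose G) + rowPairs fl G)
    ≡⟨ cong (λ p → penalties G + (p + rowPairs fl G)) (∑-swap w h _) ⟩
  penalties G + (∑ h (λ i → ∑ w (V fl i)) + ∑ h (λ i → ∑ w (H fl i)))
    ≡⟨ cong (penalties G +_) (sym (∑∑-+ h w (V fl) (H fl))) ⟩
  penalties G + ∑ h (λ i → ∑ w (λ j → V fl i j + H fl i j))
    ≡⟨ sym (∑∑-+ h w (penalty G) _) ⟩
  ∑ h (λ i → ∑ w (λ j → penalty G i j + (V fl i j + H fl i j)))
    ≡⟨ ∑-cong h (λ i i<h → ∑-cong w (λ j j<w → pen-charge (at G (suc i) (suc j)) (at G i (suc j)) (at G (2 + i) (suc j))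
         (at G (suc i) j) (at G (suc i) (2 + j)) (inside G i j i<h j<w) (degree≤2 G i j i<h j<w))) ⟩
  ∑ h (λ i → ∑ w (λ j → 2 * fl (at G (suc i) (suc j)) + (V em i j + H em i j)))
    ≡⟨ ∑∑-+ h w (λ i j → 2 * fl (at G (suc i) (suc j))) _ ⟩
  ∑ h (λ i → ∑ w (λ j → 2 * fl (at G (suc i) (suc j)))) + ∑ h (λ i → ∑ w (λ j → V em i j + H em i j))
    ≡⟨ cong₂ _+_ (trans (∑-cong h (λ i _ → ∑-* w 2 _)) (∑-* h 2 _)) (∑∑-+ h w (V em) (H em)) ⟩
  2 * filled G + (∑ h (λ i → ∑ w (V em i)) + rowPairs em G)
    ≡⟨ cong (λ p → 2 * filled G + (p + rowPairs em G)) (sym (∑-swap w h _)) ⟩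
  2 * filled G + (rowPairs em (transpose G) + rowPairs em G) ∎
  where
  open ≡-Reasoning
  V H : (Cell → ℕ) → ℕ → ℕ → ℕ
  V φ i j = φ (at G (suc i) (suc j)) * (φ (at G i (suc j)) + φ (at G (2 + i) (suc j)))
  H φ i j = φ (at G (suc i) (suc j)) * (φ (at G (suc i) j) + φ (at G (suc i) (2 + j)))

borderFilled : ∀ {h w} → Grid h w → ℕ
borderFilled G = topFilled G + topFilled (flip G) + (topFilled (transpose G) + topFilled (flip (transpose G)))

-- This is 2F - 4E = B - P without subtraction, as B is twice `borderFilled G` minus the length of
-- the border. The pair counts cancel between `pen-balance` and `row-balance` for `G` and for
-- `transpose G`.
balance : ∀ {h w} (G : Grid (suc h) (suc w)) →
  4 * empties G + 2 * borderFilled G ≡ 2 * filled G + 2 * (suc h + suc w) + penalties G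
balance {h} {w} G = arith (rowPairs fl G) (rowPairs fl (transpose G)) (rowPairs em G) (rowPairs em (transpose G))
  (empties G) (filled G) (penalties G) (suc h) (suc w) (topFilled G + topFilled (flip G)) (topFilled (transpose G) + topFilled (flip (transpose G)))
  (row-balance G)
  (subst₂ (λ e f → rowPairs fl (transpose G) + 2 * e + 2 * (topFilled G + topFilled (flip G))
                   ≡ rowPairs em (transpose G) + 2 * f + 2 * suc w)
     (empties-transpose G) (filled-transpose G) (row-balance (transpose G)))
  (pen-balance G)
  where
  arith : ∀ a a′ b b′ E F P h w t l → a + 2 * E + 2 * l ≡ b + 2 * F + 2 * h → a′ + 2 * E + 2 * t ≡ b′ + 2 * F + 2 * w →
          P + (a′ + a) ≡ 2 * F + (b′ + b) → 4 * E + 2 * (t + l) ≡ 2 * F + 2 * (h + w) + P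
  arith a a′ b b′ E F P h w t l p q r = +-cancelˡ-≡ (a + a′ + (2 * F + (b′ + b))) _ _ (begin
    a + a′ + (2 * F + (b′ + b)) + (4 * E + 2 * (t + l))
      ≡⟨ l₁ a a′ (2 * F + (b′ + b)) E t l ⟩
    (a + 2 * E + 2 * l) + (a′ + 2 * E + 2 * t) + (2 * F + (b′ + b))
      ≡⟨ cong₂ _+_ (cong₂ _+_ p q) (sym r) ⟩
    (b + 2 * F + 2 * h) + (b′ + 2 * F + 2 * w) + (P + (a′ + a))
      ≡⟨ l₂ a a′ b b′ F P h w ⟩
    a + a′ + (2 * F + (b′ + b)) + (2 * F + 2 * (h + w) + P) ∎)
    where
    open ≡-Reasoning
    l₁ : ∀ a a′ c E t l → a + a′ + c + (4 * E + 2 * (t + l)) ≡ (a + 2 * E + 2 * l) + (a′ + 2 * E + 2 * t) + c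
    l₁ = solve-∀
    l₂ : ∀ a a′ b b′ F P h w → (b + 2 * F + 2 * h) + (b′ + 2 * F + 2 * w) + (P + (a′ + a))
         ≡ a + a′ + (2 * F + (b′ + b)) + (2 * F + 2 * (h + w) + P)
    l₂ = solve-∀

-- Cells as bits, and the division of the penalties among the four sides

bit : Cell → Bool
bit full = true
bit _    = false

cell : Bool → Cell
cell b = if b then full else empty

ind-bit : ∀ c → ind (bit c) ≡ fl c
ind-bit out   = refl
ind-bit empty = refl
ind-bit full  = refl

cell-bit : ∀ c → fl c + em c ≡ 1 → cell (bit c) ≡ c
cell-bit empty _ = refl
cell-bit full  _ = refl

fits-bit : ∀ c u d l r → (c ≡ full → fl u + fl d + fl l + fl r ≤ 2) →
  fits (bit c) (bit u) (bit d) (bit l) (bit r) ≡ true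
fits-bit out   u d l r _ = refl
fits-bit empty u d l r _ = refl
fits-bit full  u d l r h rewrite ind-bit u | ind-bit d | ind-bit l | ind-bit r = T⇒≡ (≤⇒≤ᵇ (h refl))
  where
  T⇒≡ : ∀ {b} → T b → b ≡ true
  T⇒≡ {true} _ = refl

-- Twice the share of the side in the penalty of a cell at depth i and at distance j from a corner:
-- the cells are split between two adjacent sides along the diagonal.
tri : ℕ → ℕ → ℕ
tri zero    zero    = 1
tri zero    (suc _) = 2
tri (suc _) zero    = 0
tri (suc i) (suc j) = tri i j

-- The arguments j and m are the distances to the two corners of the side, and the minimum is the
-- cut made by both diagonals. Layers from depth three on are dropped.
share : ℕ → ℕ → ℕ → ℕ
share 0 j m = tri 0 j ⊓ tri 0 m
share 1 j m = tri 1 j ⊓ tri 1 m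
share 2 j m = tri 2 j ⊓ tri 2 m
share _ j m = 0

tri+tri : ∀ i j → tri i j + tri j i ≡ 2
tri+tri zero    zero    = refl
tri+tri zero    (suc j) = refl
tri+tri (suc i) zero    = refl
tri+tri (suc i) (suc j) = tri+tri i j

share≤triˡ : ∀ i j m → share i j m ≤ tri i j
share≤triˡ 0 j m = m⊓n≤m _ _
share≤triˡ 1 j m = m⊓n≤m _ _
share≤triˡ 2 j m = m⊓n≤m _ _
share≤triˡ (suc (suc (suc i))) j m = z≤n

share≤triʳ : ∀ i j m → share i j m ≤ tri i m
share≤triʳ 0 j m = m⊓n≤n (tri 0 j) _
share≤triʳ 1 j m = m⊓n≤n (tri 1 j) _
share≤triʳ 2 j m = m⊓n≤n (tri 2 j) _
share≤triʳ (suc (suc (suc i))) j m = z≤n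

share-deep : ∀ {i} j m → 3 ≤ i → share i j m ≡ 0
share-deep j m (s≤s (s≤s (s≤s _))) = refl

opposite-deep : ∀ i i′ → 5 ≤ i + i′ → 3 ≤ i ⊎ 3 ≤ i′
opposite-deep 0 i′ h             = inj₂ (≤-trans (m≤m+n 3 2) h)
opposite-deep 1 i′ (s≤s h)       = inj₂ (≤-trans (m≤m+n 3 1) h)
opposite-deep 2 i′ (s≤s (s≤s h)) = inj₂ h
opposite-deep (suc (suc (suc i))) i′ h = inj₁ (s≤s (s≤s (s≤s z≤n)))

-- Of two opposite sides at least one is at depth three or more and has no share. The remaining two
-- sides meet in a corner, where `tri+tri` applies.
share-total : ∀ i i′ j j′ → 5 ≤ i + i′ → 5 ≤ j + j′ →
  share i j j′ + share i′ j j′ + (share j i i′ + share j′ i i′) ≤ 2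
share-total i i′ j j′ hi hj with opposite-deep i i′ hi | opposite-deep j j′ hj
... | inj₁ p | inj₁ q rewrite share-deep j j′ p | share-deep i i′ q =
  ≤-trans (+-mono-≤ (share≤triʳ i′ j j′) (share≤triʳ j′ i i′)) (≤-reflexive (tri+tri i′ j′))
... | inj₁ p | inj₂ q rewrite share-deep j j′ p | share-deep i i′ q | +-identityʳ (share j i i′) =
  ≤-trans (+-mono-≤ (share≤triˡ i′ j j′) (share≤triʳ j i i′)) (≤-reflexive (tri+tri i′ j))
... | inj₂ p | inj₁ q rewrite share-deep j j′ p | share-deep i i′ q | +-identityʳ (share i j j′) =
  ≤-trans (+-mono-≤ (share≤triʳ i j j′) (share≤triˡ j′ i i′)) (≤-reflexive (tri+tri i j′))
... | inj₂ p | inj₂ q rewrite share-deep j j′ p | share-deep i i′ q | +-identityʳ (share i j j′) | +-identityʳ (share j i i′) =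
  ≤-trans (+-mono-≤ (share≤triˡ i j j′) (share≤triˡ j i i′)) (≤-reflexive (tri+tri i j))

sideLoss : ∀ {h w} → Grid h w → ℕ
sideLoss {h} {w} G = ∑ h (λ i → ∑ w (λ j → share i j (w ∸ suc j) * penalty G i j))

sideLoss-flip : ∀ {h w} (G : Grid h w) →
  sideLoss (flip G) ≡ ∑ h (λ i → ∑ w (λ j → share (h ∸ suc i) j (w ∸ suc j) * penalty G i j))
sideLoss-flip {h} {w} G = trans (∑-rev h _)
  (∑-cong h (λ i i<h → ∑-cong w (λ j _ → cong (share (h ∸ suc i) j (w ∸ suc j) *_)
    (trans (penalty-flip G j (flip< i<h)) (cong (λ k → penalty G k j) (twice i<h))))))
  where
  twice : ∀ {i} → i < h → h ∸ suc (h ∸ suc i) ≡ i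
  twice i<h = trans (cong (h ∸_) (sym (flip₁ i<h))) (m∸[m∸n]≡n (<⇒≤ i<h))

-- `share-total` weighted with the penalties and summed over all cells; the factor 2 is there
-- because `tri` counts in halves.
sideLoss-total : ∀ {h w} (G : Grid h w) → 6 ≤ h → 6 ≤ w →
  sideLoss G + sideLoss (flip G) + (sideLoss (transpose G) + sideLoss (flip (transpose G))) ≤ 2 * penalties G
sideLoss-total {h} {w} G 6≤h 6≤w = begin
  sideLoss G + sideLoss (flip G) + (sideLoss (transpose G) + sideLoss (flip (transpose G)))
    ≡⟨ cong₂ _+_ (cong (sideLoss G +_) (sideLoss-flip G)) (cong₂ _+_
         (trans (∑-cong w (λ j _ → ∑-cong h (λ i _ → cong (share j i (h ∸ suc i) *_) (penalty-transpose G i j)))) (∑-swap w h _))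
         (trans (trans (sideLoss-flip (transpose G)) (∑-cong w (λ j _ → ∑-cong h (λ i _ → cong (share (w ∸ suc j) i (h ∸ suc i) *_) (penalty-transpose G i j))))) (∑-swap w h _))) ⟩
  ∑∑ (λ i j → s₁ i j * p i j) + ∑∑ (λ i j → s₂ i j * p i j) + (∑∑ (λ i j → s₃ i j * p i j) + ∑∑ (λ i j → s₄ i j * p i j))
    ≡⟨ cong₂ _+_ (sym (∑∑-+ h w _ _)) (sym (∑∑-+ h w _ _)) ⟩
  ∑∑ (λ i j → s₁ i j * p i j + s₂ i j * p i j) + ∑∑ (λ i j → s₃ i j * p i j + s₄ i j * p i j)
    ≡⟨ sym (∑∑-+ h w _ _) ⟩
  ∑∑ (λ i j → s₁ i j * p i j + s₂ i j * p i j + (s₃ i j * p i j + s₄ i j * p i j))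
    ≤⟨ ∑-mono h (λ i i<h → ∑-mono w (λ j j<w → ≤-trans
         (≤-reflexive (lemma (s₁ i j) (s₂ i j) (s₃ i j) (s₄ i j) (p i j)))
         (*-monoˡ-≤ (p i j) (share-total i (h ∸ suc i) j (w ∸ suc j) (far i<h 6≤h) (far j<w 6≤w))))) ⟩
  ∑∑ (λ i j → 2 * p i j)
    ≡⟨ trans (∑-cong h (λ i _ → ∑-* w 2 _)) (∑-* h 2 _) ⟩
  2 * penalties G ∎
  where
  open ≤-Reasoning
  ∑∑ : (ℕ → ℕ → ℕ) → ℕ
  ∑∑ f = ∑ h (λ i → ∑ w (f i))
  p s₁ s₂ s₃ s₄ : ℕ → ℕ → ℕ
  p = penalty G
  s₁ i j = share i j (w ∸ suc j)
  s₂ i j = share (h ∸ suc i) j (w ∸ suc j)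
  s₃ i j = share j i (h ∸ suc i)
  s₄ i j = share (w ∸ suc j) i (h ∸ suc i)
  lemma : ∀ a b c d p → a * p + b * p + (c * p + d * p) ≡ (a + b + (c + d)) * p
  lemma = solve-∀
  far : ∀ {n i} → i < n → 6 ≤ n → 5 ≤ i + (n ∸ suc i)
  far {n} {i} i<n 6≤n = s≤s⁻¹ (≤-trans 6≤n (≤-reflexive (sym (m+[n∸m]≡n i<n))))

-- The strip of depth three along a side

-- Penalty of a cell in the third layer as seen without its neighbour in the fourth.
pen′ : Cell → Cell → Cell → Cell → ℕ
pen′ empty u l r = em u + em l + em r
pen′ _     _ _ _ = 0

pen′≤pen : ∀ x u d l r → pen′ x u l r ≤ pen x u d l r
pen′≤pen out   u d l r = z≤n
pen′≤pen empty u d l r = +-monoˡ-≤ (em r) (+-monoˡ-≤ (em l) (m≤m+n (em u) (em d)))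
pen′≤pen full  u d l r = z≤n

-- A bit cannot express an outer cell, so this is read off from the number of columns on that side.
-- Unlike an empty neighbour, an outer one costs an empty cell nothing.
beside : ℕ → Bool → Cell
beside zero    _ = out
beside (suc _) b = cell b

-- The constant 20 keeps the truncated subtraction exact.
sideVal : ℕ → ℕ → Bits 3 → Bits 3 → Bits 3 → ℕ
sideVal k n (a₀ ∷ a₁ ∷ a₂ ∷ []) (b₀ ∷ b₁ ∷ b₂ ∷ []) (c₀ ∷ c₁ ∷ c₂ ∷ []) =
  (20 + 4 * ind b₀) ∸
    ( share 0 k n * pen (cell b₀) out (cell b₁) (beside k a₀) (beside n c₀)
    + share 1 k n * pen (cell b₁) (cell b₀) (cell b₂) (beside k a₁) (beside n c₁)
    + share 2 k n * pen′ (cell b₂) (cell b₁) (beside k a₂) (beside n c₂))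

open Chain sideVal using () renaming (value to sideValue; value-≤ to sideValue-≤; value-blank-≤ to sideValue-blank-≤;
  value-step to sideValue-step; value-upper to sideValue-upper)

-- Twice the bounds 3, 5/2 and 2 on the contribution of a side, doubled like the shares in `tri`.
-- Lengths are taken modulo 3, so 6 + n may be replaced by n.
slack : ℕ → ℕ
slack 0 = 6
slack 1 = 5
slack 2 = 4
slack (suc (suc (suc n))) = slack n

-- With three or more columns to come, the far corner neither touches the column nor takes a share
-- of its three cells.
sideVal-far : ∀ k n n′ a b c → sideVal k (3 + n) a b c ≡ sideVal k (3 + n′) a b c
sideVal-far k n n′ (_ ∷ _ ∷ _ ∷ []) (_ ∷ _ ∷ _ ∷ []) (_ ∷ _ ∷ _ ∷ []) = refl

-- 66 = 3 · 22, where 22 = 20 + 2 is the shifted value of a column of an average word.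
sideValue-periodic : ∀ m a b → sideValue 3 (9 + m) a b ≤ sideValue 3 (6 + m) a b + 66
sideValue-periodic zero    = sideValue-≤ 3 9 6 66 refl
sideValue-periodic (suc m) = sideValue-step 3 66 (sideVal-far 3 (6 + m) (3 + m)) (sideValue-periodic m)

-- Lengths 6 to 11 are evaluated. Beyond them, the three columns near the first corner (k = 0, 1, 2)
-- are prepended to `sideValue-periodic`, so three more columns add at most 66.
sideValue-bound : ∀ n b → sideValue 0 (6 + n) blank b ≤ 22 * (6 + n) + slack n
sideValue-bound 0 = sideValue-blank-≤ 0 6 (22 * 6 + 6) refl
sideValue-bound 1 = sideValue-blank-≤ 0 7 (22 * 7 + 5) refl
sideValue-bound 2 = sideValue-blank-≤ 0 8 (22 * 8 + 4) refl
sideValue-bound 3 = sideValue-blank-≤ 0 9 (22 * 9 + 6) refl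
sideValue-bound 4 = sideValue-blank-≤ 0 10 (22 * 10 + 5) refl
sideValue-bound 5 = sideValue-blank-≤ 0 11 (22 * 11 + 4) refl
sideValue-bound (suc (suc (suc (suc (suc (suc m)))))) b = begin
  sideValue 0 (12 + m) blank b
    ≤⟨ sideValue-step 0 66 (sideVal-far 0 (8 + m) (5 + m))
        (sideValue-step 1 66 (sideVal-far 1 (7 + m) (4 + m))
          (sideValue-step 2 66 (sideVal-far 2 (6 + m) (3 + m)) (sideValue-periodic m))) blank b ⟩
  sideValue 0 (9 + m) blank b + 66
    ≤⟨ +-monoˡ-≤ 66 (sideValue-bound (suc (suc (suc m))) b) ⟩
  22 * (9 + m) + slack m + 66
    ≡⟨ lemma m (slack m) ⟩
  22 * (12 + m) + slack m ∎
  where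
  open ≤-Reasoning
  lemma : ∀ m s → 22 * (9 + m) + s + 66 ≡ 22 * (12 + m) + s
  lemma = solve-∀

clip-far : ∀ i → clip (3 + i) ≡ 3
clip-far zero    = refl
clip-far (suc i) = cong next (clip-far i)

-- In the first three layers the diagonal cut has no effect at distance three or more from the
-- corner.
share-clip : ∀ r j m → r < 3 → share r (clip j) m ≡ share r j m
share-clip r 0 m _ = refl
share-clip r 1 m _ = refl
share-clip r 2 m _ = refl
share-clip r (suc (suc (suc j))) m r<3 rewrite clip-far j = far r r<3
  where
  far : ∀ r → r < 3 → share r 3 m ≡ share r (3 + j) m
  far 0 _ = refl
  far 1 _ = refl
  far 2 _ = refl
  far (suc (suc (suc r))) (s≤s (s≤s (s≤s ())))

beside-next : ∀ k b → beside (next k) b ≡ cell b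
beside-next 0 b = refl
beside-next 1 b = refl
beside-next (suc (suc k)) b = refl

module Side {h n : ℕ} (G : Grid (3 + h) (6 + n)) where
  w : ℕ
  w = 6 + n

  column : ℕ → Bits 3
  column j = bit (at G 1 j) ∷ bit (at G 2 j) ∷ bit (at G 3 j) ∷ []

  column-0 : column 0 ≡ blank
  column-0 rewrite left G 1 | left G 2 | left G 3 = refl

  r<h : ∀ {r} → r < 3 → r < 3 + h
  r<h p = ≤-trans p (m≤m+n 3 h)

  1<3 : 1 < 3
  1<3 = s≤s (s≤s z≤n)

  centre : ∀ r j → r < 3 → j < w → cell (bit (at G (suc r) (suc j))) ≡ at G (suc r) (suc j)
  centre r j r<3 j<w = cell-bit _ (inside G r j (r<h r<3) j<w)

  before : ∀ r i → r < 3 → i < w → beside (clip i) (bit (at G (suc r) i)) ≡ at G (suc r) i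
  before r zero    _   _   = sym (left G (suc r))
  before r (suc i) r<3 i<w = trans (beside-next (clip i) _) (centre r i r<3 (<-trans ≤-refl i<w))

  after : ∀ r i m → r < 3 → i + suc m ≡ w → beside m (bit (at G (suc r) (2 + i))) ≡ at G (suc r) (2 + i)
  after r i zero    r<3 eq = sym (trans (cong (λ k → at G (suc r) (suc k)) (trans (+-comm 1 i) eq)) (right G (suc r)))
  after r i (suc m) r<3 eq = centre r (suc i) r<3
    (≤-trans (m≤m+n (2 + i) m) (≤-reflexive (trans (sym (trans (+-suc i (suc m)) (cong suc (+-suc i m)))) eq)))

  legal : ∀ i → i < w → Legal false (column i) (column (1 + i)) (column (2 + i))
  legal i i<w
    = fits-bit (at G 1 (suc i)) out (at G 2 (suc i)) (at G 1 i) (at G 1 (2 + i))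
        (λ eq → subst (λ c → fl c + fl (at G 2 (suc i)) + fl (at G 1 i) + fl (at G 1 (2 + i)) ≤ 2)
                      (top G (suc i)) (degree≤2 G 0 i (s≤s z≤n) i<w eq))
    , fits-bit (at G 2 (suc i)) (at G 1 (suc i)) (at G 3 (suc i)) (at G 2 i) (at G 2 (2 + i))
        (degree≤2 G 1 i (s≤s (s≤s z≤n)) i<w)
    -- The strip ends here: the neighbour in the fourth layer is replaced by an outer cell, which
    -- can only lower the degree.
    , fits-bit (at G 3 (suc i)) (at G 2 (suc i)) out (at G 3 i) (at G 3 (2 + i))
        (λ eq → ≤-trans (+-monoˡ-≤ (fl (at G 3 (2 + i))) (+-monoˡ-≤ (fl (at G 3 i)) (+-monoʳ-≤ (fl (at G 2 (suc i))) z≤n)))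
                        (degree≤2 G 2 i (s≤s (s≤s (s≤s z≤n))) i<w eq))
    , _

  loss : ℕ → ℕ
  loss i = share 0 i (w ∸ suc i) * penalty G 0 i + share 1 i (w ∸ suc i) * penalty G 1 i
         + share 2 i (w ∸ suc i) * penalty G 2 i

  -- The amount q that the table subtracts is returned as loss: its terms are the weighted penalties
  -- in the first two layers and at most the weighted penalty in the third, by `pen′≤pen`.
  bound : ∀ i m → i + suc m ≡ w →
    20 + 4 * fl (at G 1 (suc i)) ≤ sideVal (clip (i + 0)) m (column i) (column (1 + i)) (column (2 + i)) + loss i
  bound i m eq rewrite +-identityʳ i = begin
    20 + 4 * fl (at G 1 (suc i))
      ≡⟨ cong (λ p → 20 + 4 * p) (sym (ind-bit (at G 1 (suc i)))) ⟩
    g ≤⟨ m≤n+m∸n g q ⟩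
    q + (g ∸ q)
      ≡⟨ +-comm q (g ∸ q) ⟩
    (g ∸ q) + q
      ≤⟨ +-monoʳ-≤ (g ∸ q) (+-mono-≤ (+-mono-≤ (≤-reflexive (cong₂ _*_ (s≡ 0 (s≤s z≤n)) p₀)) (≤-reflexive (cong₂ _*_ (s≡ 1 1<3) p₁)))
           (*-mono-≤ (≤-reflexive (s≡ 2 ≤-refl)) p₂)) ⟩
    (g ∸ q) + loss i ∎
    where
    open ≤-Reasoning
    b : ℕ → ℕ → Bool
    b r j = bit (at G (suc r) j)
    q₀ q₁ q₂ q g : ℕ
    q₀ = pen (cell (b 0 (suc i))) out (cell (b 1 (suc i))) (beside (clip i) (b 0 i)) (beside m (b 0 (2 + i)))
    q₁ = pen (cell (b 1 (suc i))) (cell (b 0 (suc i))) (cell (b 2 (suc i))) (beside (clip i) (b 1 i)) (beside m (b 1 (2 + i)))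
    q₂ = pen′ (cell (b 2 (suc i))) (cell (b 1 (suc i))) (beside (clip i) (b 2 i)) (beside m (b 2 (2 + i)))
    q = share 0 (clip i) m * q₀ + share 1 (clip i) m * q₁ + share 2 (clip i) m * q₂
    g = 20 + 4 * ind (b 0 (suc i))
    i<w : i < w
    i<w = ≤-trans (m≤m+n (suc i) m) (≤-reflexive (trans (sym (+-suc i m)) eq))
    m≡ : m ≡ w ∸ suc i
    m≡ = trans (sym (m+n∸m≡n (suc i) m)) (cong (_∸ suc i) (trans (sym (+-suc i m)) eq))
    s≡ : ∀ r → r < 3 → share r (clip i) m ≡ share r i (w ∸ suc i)
    s≡ r r<3 = trans (share-clip r i m r<3) (cong (share r i) m≡)
    p₀ : q₀ ≡ penalty G 0 i
    p₀ rewrite centre 0 i (s≤s z≤n) i<w | centre 1 i 1<3 i<w | before 0 i (s≤s z≤n) i<w | after 0 i m (s≤s z≤n) eq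
             | top G (suc i) = refl
    p₁ : q₁ ≡ penalty G 1 i
    p₁ rewrite centre 0 i (s≤s z≤n) i<w | centre 1 i 1<3 i<w | centre 2 i ≤-refl i<w | before 1 i 1<3 i<w | after 1 i m 1<3 eq
      = refl
    p₂ : q₂ ≤ penalty G 2 i
    p₂ rewrite centre 1 i 1<3 i<w | centre 2 i ≤-refl i<w | before 2 i ≤-refl i<w | after 2 i m ≤-refl eq
      = pen′≤pen (at G 3 (suc i)) _ _ _ _

  loss-total : ∑ w loss ≡ sideLoss G
  loss-total = begin
    ∑ w loss
      ≡⟨ trans (∑-+ w (λ i → s 0 i + s 1 i) (s 2)) (cong (_+ ∑ w (s 2)) (∑-+ w (s 0) (s 1))) ⟩
    ∑ w (s 0) + ∑ w (s 1) + ∑ w (s 2)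
      ≡⟨ lemma (∑ w (s 0)) (∑ w (s 1)) (∑ w (s 2)) ⟩
    ∑ w (s 0) + (∑ w (s 1) + (∑ w (s 2) + 0))
      ≡⟨ cong (λ z → ∑ w (s 0) + (∑ w (s 1) + (∑ w (s 2) + z))) (sym (∑-zero h (λ i _ → ∑-zero w (λ j _ → refl)))) ⟩
    sideLoss G ∎
    where
    open ≡-Reasoning
    s : ℕ → ℕ → ℕ
    s r i = share r i (w ∸ suc i) * penalty G r i
    lemma : ∀ a b c → a + b + c ≡ a + (b + (c + 0))
    lemma = solve-∀

  -- The tables give 22 per column, of which 20 is the shift built into `sideVal`; the shift cancels
  -- and 2 per column remains.
  side-bound : 4 * topFilled G ≤ 2 * w + slack n + sideLoss G
  side-bound = +-cancelˡ-≤ (20 * w) _ _ (begin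
    20 * w + 4 * topFilled G
      ≡⟨ cong₂ _+_ (trans (*-comm 20 w) (sym (∑-const w 20))) (sym (∑-* w 4 (λ j → fl (at G 1 (suc j))))) ⟩
    ∑ w (λ _ → 20) + ∑ w (λ j → 4 * fl (at G 1 (suc j)))
      ≡⟨ sym (∑-+ w (λ _ → 20) (λ j → 4 * fl (at G 1 (suc j)))) ⟩
    ∑ w (λ j → 20 + 4 * fl (at G 1 (suc j)))
      ≤⟨ sideValue-upper w 0 column _ loss legal bound ⟩
    sideValue 0 w (column 0) (column 1) + ∑ w loss
      ≤⟨ +-mono-≤ (subst (λ c → sideValue 0 w c (column 1) ≤ 22 * w + slack n) (sym column-0) (sideValue-bound n (column 1)))
                  (≤-reflexive loss-total) ⟩
    22 * w + slack n + sideLoss G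
      ≡⟨ lemma w (slack n) (sideLoss G) ⟩
    20 * w + (2 * w + slack n + sideLoss G) ∎)
    where
    open ≤-Reasoning
    lemma : ∀ w s l → 22 * w + s + l ≡ 20 * w + (2 * w + s + l)
    lemma = solve-∀

-- `balance` is doubled and its border term estimated by `side-bound` on all four sides. By
-- `sideLoss-total` the losses are absorbed by 2P, and eliminating E through the area leaves twice
-- the claim.
frame-bound : ∀ {m n} (G : Grid (6 + m) (6 + n)) →
  6 * filled G ≤ 4 * ((6 + m) * (6 + n)) + (slack m + slack n)
frame-bound {m} {n} G = arith (filled G) (empties G) (penalties G) h w (slack m) (slack n)
    (topFilled G) (topFilled (flip G)) (topFilled (transpose G)) (topFilled (flip (transpose G)))
    (sideLoss G) (sideLoss (flip G)) (sideLoss (transpose G)) (sideLoss (flip (transpose G)))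
    (h * w)
    (balance G) (filled+empties G)
    (Side.side-bound G) (Side.side-bound (flip G)) (Side.side-bound (transpose G)) (Side.side-bound (flip (transpose G)))
    (sideLoss-total G (m≤m+n 6 m) (m≤m+n 6 n))
  where
  h w : ℕ
  h = 6 + m
  w = 6 + n
  arith : ∀ F E P h w sh sw t b l r t′ b′ l′ r′ A →
    4 * E + 2 * (t + b + (l + r)) ≡ 2 * F + 2 * (h + w) + P → F + E ≡ A →
    4 * t ≤ 2 * w + sw + t′ → 4 * b ≤ 2 * w + sw + b′ → 4 * l ≤ 2 * h + sh + l′ → 4 * r ≤ 2 * h + sh + r′ →
    t′ + b′ + (l′ + r′) ≤ 2 * P → 6 * F ≤ 4 * A + (sh + sw)
  arith F E P h w sh sw t b l r t′ b′ l′ r′ A bal area ht hb hl hr hP =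
    *-cancelˡ-≤ 2 (+-cancelˡ-≤ (4 * (h + w) + 2 * P) _ _ (begin
      4 * (h + w) + 2 * P + 2 * (6 * F)
        ≡⟨ l₁ F P h w ⟩
      2 * (2 * F + 2 * (h + w) + P) + 8 * F
        ≡⟨ cong (λ p → 2 * p + 8 * F) (sym bal) ⟩
      2 * (4 * E + 2 * (t + b + (l + r))) + 8 * F
        ≡⟨ l₂ F E t b l r ⟩
      8 * (F + E) + ((4 * t + 4 * b) + (4 * l + 4 * r))
        ≤⟨ +-monoʳ-≤ (8 * (F + E)) (+-mono-≤ (+-mono-≤ ht hb) (+-mono-≤ hl hr)) ⟩
      8 * (F + E) + ((2 * w + sw + t′ + (2 * w + sw + b′)) + (2 * h + sh + l′ + (2 * h + sh + r′)))
        ≡⟨ l₃ (F + E) h w sh sw t′ b′ l′ r′ ⟩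
      8 * (F + E) + 4 * (h + w) + 2 * (sh + sw) + (t′ + b′ + (l′ + r′))
        ≤⟨ +-monoʳ-≤ (8 * (F + E) + 4 * (h + w) + 2 * (sh + sw)) hP ⟩
      8 * (F + E) + 4 * (h + w) + 2 * (sh + sw) + 2 * P
        ≡⟨ cong (λ p → 8 * p + 4 * (h + w) + 2 * (sh + sw) + 2 * P) area ⟩
      8 * A + 4 * (h + w) + 2 * (sh + sw) + 2 * P
        ≡⟨ l₄ A h w (sh + sw) P ⟩
      4 * (h + w) + 2 * P + 2 * (4 * A + (sh + sw)) ∎))
    where
    open ≤-Reasoning
    l₁ : ∀ F P h w → 4 * (h + w) + 2 * P + 2 * (6 * F) ≡ 2 * (2 * F + 2 * (h + w) + P) + 8 * F
    l₁ = solve-∀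
    l₂ : ∀ F E t b l r → 2 * (4 * E + 2 * (t + b + (l + r))) + 8 * F ≡ 8 * (F + E) + ((4 * t + 4 * b) + (4 * l + 4 * r))
    l₂ = solve-∀
    l₃ : ∀ S h w sh sw t′ b′ l′ r′ → 8 * S + ((2 * w + sw + t′ + (2 * w + sw + b′)) + (2 * h + sh + l′ + (2 * h + sh + r′)))
         ≡ 8 * S + 4 * (h + w) + 2 * (sh + sw) + (t′ + b′ + (l′ + r′))
    l₃ = solve-∀
    l₄ : ∀ A h w s P → 8 * A + 4 * (h + w) + 2 * s + 2 * P ≡ 4 * (h + w) + 2 * P + 2 * (4 * A + s)
    l₄ = solve-∀

-- Grids of words

ext : ∀ {n} {A : Set} → A → (Fin n → A) → ℕ → A
ext {zero}  z f _       = z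
ext {suc n} z f zero    = f fzero
ext {suc n} z f (suc k) = ext z (λ i → f (fsuc i)) k

-- Index 0 and all indices beyond n carry the default value, as the outer ring of a `Grid` requires.
pad : ∀ {n} {A : Set} → A → (Fin n → A) → ℕ → A
pad z f zero    = z
pad z f (suc k) = ext z f k

ext-end : ∀ n {A : Set} (z : A) (f : Fin n → A) → ext z f n ≡ z
ext-end zero    z f = refl
ext-end (suc n) z f = ext-end n z _

ext-const : ∀ n {A : Set} (z : A) (f : Fin n → A) k → (∀ i → f i ≡ z) → ext z f k ≡ z
ext-const zero    z f k       h = refl
ext-const (suc n) z f zero    h = h fzero
ext-const (suc n) z f (suc k) h = ext-const n z _ k (λ i → h (fsuc i))

pad-const : ∀ {n} {A : Set} (z : A) (f : Fin n → A) k → (∀ i → f i ≡ z) → pad z f k ≡ z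
pad-const z f zero    h = refl
pad-const z f (suc k) h = ext-const _ z f k h

ext-cong : ∀ {n} {A : Set} (z : A) {f g : Fin n → A} k → (∀ i → f i ≡ g i) → ext z f k ≡ ext z g k
ext-cong {zero}  z k       h = refl
ext-cong {suc n} z zero    h = h fzero
ext-cong {suc n} z (suc k) h = ext-cong z k (λ i → h (fsuc i))

pad-cong : ∀ {n} {A : Set} (z : A) {f g : Fin n → A} k → (∀ i → f i ≡ g i) → pad z f k ≡ pad z g k
pad-cong z zero    h = refl
pad-cong z (suc k) h = ext-cong z k h

ext-map : ∀ {n} {A B : Set} (g : A → B) (z : A) (f : Fin n → A) k → g (ext z f k) ≡ ext (g z) (λ i → g (f i)) k
ext-map {zero}  g z f k       = refl
ext-map {suc n} g z f zero    = refl
ext-map {suc n} g z f (suc k) = ext-map g z (λ i → f (fsuc i)) k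

pad-map : ∀ {n} {A B : Set} (g : A → B) (z : A) (f : Fin n → A) k → g (pad z f k) ≡ pad (g z) (λ i → g (f i)) k
pad-map g z f zero    = refl
pad-map g z f (suc k) = ext-map g z f k

ext-toℕ : ∀ {n} {A : Set} (z : A) (f : Fin n → A) i → ext z f (toℕ i) ≡ f i
ext-toℕ z f fzero    = refl
ext-toℕ z f (fsuc i) = ext-toℕ z _ i

sumFin-cong : ∀ n {f g : Fin n → ℕ} → (∀ i → f i ≡ g i) → sumFin n f ≡ sumFin n g
sumFin-cong zero    h = refl
sumFin-cong (suc n) h = cong₂ _+_ (h fzero) (sumFin-cong n (λ i → h (fsuc i)))

sumFin-zero : ∀ n {f : Fin n → ℕ} → (∀ i → f i ≡ 0) → sumFin n f ≡ 0
sumFin-zero zero    h = refl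
sumFin-zero (suc n) h = cong₂ _+_ (h fzero) (sumFin-zero n (λ i → h (fsuc i)))

sumFin-∑ : ∀ n (f : Fin n → ℕ) (φ : ℕ → ℕ) → (∀ i → f i ≡ φ (toℕ i)) → sumFin n f ≡ ∑ n φ
sumFin-∑ zero    f φ h = refl
sumFin-∑ (suc n) f φ h = cong₂ _+_ (h fzero) (sumFin-∑ n _ _ (λ i → h (fsuc i)))

-- Only a itself and the indices before and after it contribute; `pad 0` supplies 0 where one of
-- these two does not exist.
sumFin-near : ∀ n (a : Fin n) (φ : ℕ → Fin n → ℕ) → (∀ d k → φ (2 + d) k ≡ 0) →
  sumFin n (λ k → φ ∣ toℕ a - toℕ k ∣ k) ≡ φ 0 a + (pad 0 (φ 1) (toℕ a) + pad 0 (φ 1) (2 + toℕ a))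
sumFin-near (suc zero) fzero φ far = refl
sumFin-near (suc (suc n)) fzero φ far = cong (φ 0 fzero +_)
  (trans (cong (φ 1 (fsuc fzero) +_) (sumFin-zero n (λ k → far (toℕ k) (fsuc (fsuc k))))) (+-identityʳ _))
sumFin-near (suc n) (fsuc fzero) φ far = trans
  (cong (φ 1 fzero +_) (sumFin-near n fzero (λ d k → φ d (fsuc k)) (λ d k → far d (fsuc k))))
  (lemma (φ 1 fzero) (φ 0 (fsuc fzero)) _)
  where
  lemma : ∀ a b c → a + (b + c) ≡ b + (a + c)
  lemma = solve-∀
sumFin-near (suc n) (fsuc a@(fsuc a′)) φ far = trans
  (cong (_+ sumFin n (λ k → φ ∣ toℕ a - toℕ k ∣ (fsuc k))) (far (toℕ a′) fzero))
  (sumFin-near n a (λ d k → φ d (fsuc k)) (λ d k → far d (fsuc k)))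

module _ {h w : ℕ} (W : Word h w) where
  wordAt : ℕ → ℕ → Cell
  wordAt i j = pad out (λ a → pad out (λ b → cell (W a b)) j) i

  fl-cell : ∀ b → fl (cell b) ≡ ind b
  fl-cell true  = refl
  fl-cell false = refl

  fl-wordAt : ∀ i j → fl (wordAt i j) ≡ pad 0 (λ a → pad 0 (λ b → ind (W a b)) j) i
  fl-wordAt i j = trans (pad-map fl out _ i)
    (pad-cong 0 i (λ a → trans (pad-map fl out _ j) (pad-cong 0 j (λ b → fl-cell (W a b)))))

  wordAt-cell : ∀ a b → wordAt (suc (toℕ a)) (suc (toℕ b)) ≡ cell (W a b)
  wordAt-cell a b = trans (ext-toℕ out _ a) (ext-toℕ out _ b)

  -- `sumFin-near` is applied within each row and then to the sum over the rows, where `ψ d i` is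
  -- the contribution of row i at distance d. For d = 0 only the two horizontal neighbours survive,
  -- for d = 1 only the cell in column b.
  degree-wordAt : ∀ a b → degree W a b ≡
    fl (wordAt (toℕ a) (suc (toℕ b))) + fl (wordAt (2 + toℕ a) (suc (toℕ b)))
      + fl (wordAt (suc (toℕ a)) (toℕ b)) + fl (wordAt (suc (toℕ a)) (2 + toℕ b))
  degree-wordAt a b = begin
    degree W a b
      ≡⟨ sumFin-cong h (λ i → sumFin-near w b (λ e k → ind ((∣ toℕ a - toℕ i ∣ + e ≡ᵇ 1) ∧ W i k)) (far ∣ toℕ a - toℕ i ∣ i)) ⟩
    sumFin h (λ i → ψ ∣ toℕ a - toℕ i ∣ i)
      ≡⟨ sumFin-near h a ψ (λ d i → cong₂ _+_ (pad-const {w} 0 _ (toℕ b) (λ _ → refl)) (pad-const {w} 0 _ (2 + toℕ b) (λ _ → refl))) ⟩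
    ψ 0 a + (pad 0 (ψ 1) (toℕ a) + pad 0 (ψ 1) (2 + toℕ a))
      ≡⟨ cong₂ _+_ (cong₂ _+_ (across (toℕ b)) (across (2 + toℕ b))) (cong₂ _+_ (along (toℕ a)) (along (2 + toℕ a))) ⟩
    fl (wordAt (suc (toℕ a)) (toℕ b)) + fl (wordAt (suc (toℕ a)) (2 + toℕ b))
      + (fl (wordAt (toℕ a) (suc (toℕ b))) + fl (wordAt (2 + toℕ a) (suc (toℕ b))))
      ≡⟨ lemma (fl (wordAt (suc (toℕ a)) (toℕ b))) (fl (wordAt (suc (toℕ a)) (2 + toℕ b)))
           (fl (wordAt (toℕ a) (suc (toℕ b)))) (fl (wordAt (2 + toℕ a) (suc (toℕ b)))) ⟩
    fl (wordAt (toℕ a) (suc (toℕ b))) + fl (wordAt (2 + toℕ a) (suc (toℕ b)))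
      + fl (wordAt (suc (toℕ a)) (toℕ b)) + fl (wordAt (suc (toℕ a)) (2 + toℕ b)) ∎
    where
    open ≡-Reasoning
    ψ : ℕ → Fin h → ℕ
    ψ d i = ind ((d + 0 ≡ᵇ 1) ∧ W i b) + (pad 0 (λ k → ind ((d + 1 ≡ᵇ 1) ∧ W i k)) (toℕ b)
                                         + pad 0 (λ k → ind ((d + 1 ≡ᵇ 1) ∧ W i k)) (2 + toℕ b))
    far : ∀ d i e k → ind ((d + (2 + e) ≡ᵇ 1) ∧ W i k) ≡ 0
    far d i e k rewrite +-comm d (2 + e) = refl
    across : ∀ j → pad 0 (λ k → ind (W a k)) j ≡ fl (wordAt (suc (toℕ a)) j)
    across j = sym (trans (fl-wordAt (suc (toℕ a)) j) (ext-toℕ 0 (λ i → pad 0 (λ k → ind (W i k)) j) a))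
    along : ∀ i → pad 0 (ψ 1) i ≡ fl (wordAt i (suc (toℕ b)))
    along i = trans (pad-cong 0 i (λ k → trans
        (cong₂ (λ p q → ind (W k b) + (p + q)) (pad-const {w} 0 _ (toℕ b) (λ _ → refl)) (pad-const {w} 0 _ (2 + toℕ b) (λ _ → refl)))
        (trans (+-identityʳ _) (sym (ext-toℕ 0 (λ j → ind (W k j)) b)))))
      (sym (fl-wordAt i (suc (toℕ b))))
    lemma : ∀ l r u d → l + r + (u + d) ≡ u + d + l + r
    lemma = solve-∀

  filledCount-wordAt : filledCount W ≡ ∑ h (λ i → ∑ w (λ j → fl (wordAt (suc i) (suc j))))
  filledCount-wordAt = sumFin-∑ h _ _ (λ a → sumFin-∑ w _ _ (λ b → sym (trans (cong fl (wordAt-cell a b)) (fl-cell (W a b)))))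

  wordGrid : InW2 W → Grid h w
  wordGrid w2 = record
    { at     = wordAt
    ; top    = λ j → refl
    ; bottom = λ j → ext-end h out _
    ; left   = λ i → pad-const out _ i (λ _ → refl)
    ; right  = λ i → pad-const out _ i (λ _ → ext-end w out _)
    ; inside = λ i j i<h j<w → onFin (λ i j → fl (wordAt (suc i) (suc j)) + em (wordAt (suc i) (suc j)) ≡ 1)
        (λ a b → subst (λ c → fl c + em c ≡ 1) (sym (wordAt-cell a b)) (bit-or-not (W a b))) i j i<h j<w
    ; degree≤2 = λ i j i<h j<w → onFin (λ i j → wordAt (suc i) (suc j) ≡ full →
          fl (wordAt i (suc j)) + fl (wordAt (2 + i) (suc j)) + fl (wordAt (suc i) j) + fl (wordAt (suc i) (2 + j)) ≤ 2)
        (λ a b eq → subst (_≤ 2) (degree-wordAt a b) (w2 a b (full-true (W a b) (trans (sym (wordAt-cell a b)) eq)))) i j i<h j<w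
    }
    where
    bit-or-not : ∀ b → fl (cell b) + em (cell b) ≡ 1
    bit-or-not true  = refl
    bit-or-not false = refl
    full-true : ∀ b → cell b ≡ full → b ≡ true
    full-true true _ = refl
    onFin : (P : ℕ → ℕ → Set) → (∀ (a : Fin h) (b : Fin w) → P (toℕ a) (toℕ b)) → ∀ i j → i < h → j < w → P i j
    onFin P p i j i<h j<w = subst₂ P (toℕ-fromℕ< i<h) (toℕ-fromℕ< j<w) (p (fromℕ< i<h) (fromℕ< j<w))

-- The diagonal words

≡ᵇ-refl : ∀ n → (n ≡ᵇ n) ≡ true
≡ᵇ-refl zero    = refl
≡ᵇ-refl (suc n) = ≡ᵇ-refl n

<⇒≡ᵇ-false : ∀ {m n} → m < n → (m ≡ᵇ n) ≡ false
<⇒≡ᵇ-false {zero}  (s≤s _)   = refl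
<⇒≡ᵇ-false {suc m} (s≤s m<n) = <⇒≡ᵇ-false m<n

≡ᵇ-true : ∀ m n → (m ≡ᵇ n) ≡ true → m ≡ n
≡ᵇ-true zero    zero    _  = refl
≡ᵇ-true (suc m) (suc n) eq = cong suc (≡ᵇ-true m n eq)

module Pattern (h w : ℕ) (p : ℕ → ℕ → Bool) where
  word : Word h w
  word i j = p (toℕ i) (toℕ j)

  word-count : filledCount word ≡ ∑ h (λ i → ∑ w (λ j → ind (p i j)))
  word-count = sumFin-∑ h _ _ (λ a → sumFin-∑ w _ _ (λ b → refl))

  c : ℕ → ℕ → ℕ
  c i j = fl (wordAt word i j)

  ext-≤ : ∀ n (f : Fin n → Cell) (φ : ℕ → ℕ) k → (∀ i → fl (f i) ≤ φ (toℕ i)) → fl (ext out f k) ≤ φ k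
  ext-≤ zero    f φ k       h = z≤n
  ext-≤ (suc n) f φ zero    h = h fzero
  ext-≤ (suc n) f φ (suc k) h = ext-≤ n _ (λ i → φ (suc i)) k (λ i → h (fsuc i))

  -- Beyond the word the left side is 0, whatever p says there. So neighbours can be estimated by p
  -- without asking whether they lie inside.
  c≤ : ∀ i j → c (suc i) (suc j) ≤ ind (p i j)
  c≤ i j = ext-≤ h _ (λ i → ind (p i j)) i (λ a → ext-≤ w _ (λ j → ind (p (toℕ a) j)) j
    (λ b → ≤-reflexive (fl-cell word (p (toℕ a) (toℕ b)))))

  c-left : ∀ i → c i 0 ≡ 0
  c-left i = cong fl (pad-const {h} out _ i (λ _ → refl))

  c-bottom : ∀ j → c (suc h) j ≡ 0
  c-bottom j = cong fl (ext-end h out _)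

  c-right : ∀ i → c i (suc w) ≡ 0
  c-right i = cong fl (pad-const {h} out _ i (λ _ → ext-end w out _))

  c≤1 : ∀ i j → c i j ≤ 1
  c≤1 i j with wordAt word i j
  ... | out   = z≤n
  ... | empty = z≤n
  ... | full  = ≤-refl

  inW2 : (∀ i j → i < h → j < w → p i j ≡ true →
            c i (suc j) + c (2 + i) (suc j) + c (suc i) j + c (suc i) (2 + j) ≤ 2) → InW2 word
  inW2 deg a b eq = subst (_≤ 2) (sym (degree-wordAt word a b)) (deg (toℕ a) (toℕ b) (toℕ<n a) (toℕ<n b) eq)

third : ℕ → Bool
third 0 = true
third 1 = false
third 2 = false
third (suc (suc (suc n))) = third n

-- Whether i ≡ j modulo 3.
diag : ℕ → ℕ → Bool
diag zero    j       = third j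
diag (suc i) zero    = third (suc i)
diag (suc i) (suc j) = diag i j

diag-sym : ∀ i j → diag i j ≡ diag j i
diag-sym zero    zero    = refl
diag-sym zero    (suc j) = refl
diag-sym (suc i) zero    = refl
diag-sym (suc i) (suc j) = diag-sym i j

diag-period : ∀ i j → diag (3 + i) j ≡ diag i j
diag-period zero    zero    = refl
diag-period (suc i) zero    = refl
diag-period zero    1 = refl
diag-period zero    2 = refl
diag-period zero    (suc (suc (suc j))) = refl
diag-period (suc i) (suc j) = diag-period i j

-- If i - j is 1 or 2 modulo 3, then (i , suc j) or (suc i , j), respectively, lies on an empty
-- diagonal.
diag-some : ∀ i j → diag i j ≡ false → ind (not (diag (suc i) j)) + ind (not (diag i (suc j))) ≤ 1
diag-some zero    zero    ()
diag-some zero    (suc j) eq = go j eq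
  where
  go : ∀ j → third (suc j) ≡ false → ind (not (third j)) + ind (not (third (2 + j))) ≤ 1
  go 0 _ = ≤-refl
  go 1 _ = ≤-refl
  go (suc (suc (suc j))) eq = go j eq
diag-some (suc i) zero    eq = go i eq
  where
  go : ∀ j → third (suc j) ≡ false → ind (not (third (2 + j))) + ind (not (diag j 0)) ≤ 1
  go 0 _ = ≤-refl
  go 1 _ = ≤-refl
  go 2 ()
  go 3 _ = ≤-refl
  go (suc (suc (suc (suc j)))) eq = go (suc j) eq
diag-some (suc i) (suc j) eq = diag-some i j eq

module Diagonal (h′ w′ : ℕ) where
  corner : ℕ → ℕ → Bool
  corner i j = ((i ≡ᵇ 0) ∧ (j ≡ᵇ 0)) ∨ ((i ≡ᵇ suc h′) ∧ (j ≡ᵇ suc w′))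

  pattern′ : ℕ → ℕ → Bool
  pattern′ i j = not (diag i j) ∨ corner i j

  open Pattern (2 + h′) (2 + w′) pattern′ public

  off₁ : ∀ i {j} → j < suc w′ → pattern′ (suc i) j ≡ not (diag (suc i) j)
  off₁ i {j} j<w rewrite <⇒≡ᵇ-false j<w | ∧-zeroʳ (i ≡ᵇ h′) = ∨-identityʳ _

  off₂ : ∀ {i} j → i < suc h′ → pattern′ i (suc j) ≡ not (diag i (suc j))
  off₂ {i} j i<h rewrite <⇒≡ᵇ-false i<h | ∧-zeroʳ (i ≡ᵇ 0) = ∨-identityʳ _

  -- These two cells are the lower and the right neighbour of (i , j), and also the left and the
  -- upper one of (suc i , suc j). Hence the same estimate serves `down-right` and `up-left`;
  -- neither cell is one of the two refilled corners.
  pair : ∀ i j → i < suc h′ → j < suc w′ → diag i j ≡ false → ind (pattern′ (suc i) j) + ind (pattern′ i (suc j)) ≤ 1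
  pair i j i<h j<w eq rewrite off₁ i j<w | off₂ j i<h = diag-some i j eq

  up-left : ∀ i j → i < 2 + h′ → j < 2 + w′ → diag i j ≡ false → c i (suc j) + c (suc i) j ≤ 1
  up-left zero    j       _ _ _ = c≤1 1 j
  up-left (suc i) zero    _ _ _ = ≤-trans (≤-reflexive (trans (cong (c (suc i) 1 +_) (c-left (2 + i))) (+-identityʳ _))) (c≤1 (suc i) 1)
  up-left (suc i) (suc j) (s≤s i<h) (s≤s j<w) eq =
    ≤-trans (≤-reflexive (+-comm (c (suc i) (2 + j)) _))
      (≤-trans (+-mono-≤ (c≤ (suc i) j) (c≤ i (suc j))) (pair i j i<h j<w eq))

  down-right : ∀ i j → i < 2 + h′ → j < 2 + w′ → diag i j ≡ false → c (2 + i) (suc j) + c (suc i) (2 + j) ≤ 1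
  down-right i j i<h j<w eq with m≤n⇒m<n∨m≡n i<h | m≤n⇒m<n∨m≡n j<w
  ... | inj₂ refl | _ = +-mono-≤ (≤-reflexive (c-bottom (suc j))) (c≤1 (suc i) (2 + j))
  ... | inj₁ _ | inj₂ refl = +-mono-≤ (c≤1 (2 + i) (suc j)) (≤-reflexive (c-right (suc i)))
  ... | inj₁ (s≤s p) | inj₁ (s≤s q) = ≤-trans (+-mono-≤ (c≤ (suc i) j) (c≤ i (suc j))) (pair i j p q eq)

  corner-cases : ∀ i j → corner i j ≡ true → (i ≡ 0 × j ≡ 0) ⊎ (i ≡ suc h′ × j ≡ suc w′)
  corner-cases i j eq with i ≡ᵇ 0 in e₁ | j ≡ᵇ 0 in e₂ | i ≡ᵇ suc h′ in e₃ | j ≡ᵇ suc w′ in e₄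
  ... | true  | true  | _    | _    = inj₁ (≡ᵇ-true i 0 e₁ , ≡ᵇ-true j 0 e₂)
  ... | true  | false | true | true = inj₂ (≡ᵇ-true i _ e₃ , ≡ᵇ-true j _ e₄)
  ... | false | _     | true | true = inj₂ (≡ᵇ-true i _ e₃ , ≡ᵇ-true j _ e₄)

  -- Off the diagonals, each of the pairs up/left and down/right has at most one filled cell. A
  -- filled cell on a diagonal is one of the two corners, where one of these pairs lies outside the
  -- word.
  word-inW2 : InW2 word
  word-inW2 = inW2 deg
    where
    rearrange : ∀ a b c d → a + b + c + d ≡ (a + c) + (b + d)
    rearrange = solve-∀
    split : ∀ i j {m n} → c i (suc j) + c (suc i) j ≤ m → c (2 + i) (suc j) + c (suc i) (2 + j) ≤ n →
            c i (suc j) + c (2 + i) (suc j) + c (suc i) j + c (suc i) (2 + j) ≤ m + n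
    split i j p q = ≤-trans (≤-reflexive (rearrange (c i (suc j)) (c (2 + i) (suc j)) (c (suc i) j) _)) (+-mono-≤ p q)
    deg : ∀ i j → i < 2 + h′ → j < 2 + w′ → pattern′ i j ≡ true →
          c i (suc j) + c (2 + i) (suc j) + c (suc i) j + c (suc i) (2 + j) ≤ 2
    deg i j i<h j<w eq with diag i j in e
    ... | false = split i j (up-left i j i<h j<w e) (down-right i j i<h j<w e)
    ... | true with corner-cases i j eq
    ...   | inj₁ (refl , refl) = split 0 0 {0} {2} (≤-reflexive (c-left 1)) (+-mono-≤ (c≤1 2 1) (c≤1 1 2))
    ...   | inj₂ (refl , refl) = split (suc h′) (suc w′) {2} {0}
              (+-mono-≤ (c≤1 (suc h′) (2 + w′)) (c≤1 (2 + h′) (suc w′)))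
              (≤-reflexive (cong₂ _+_ (c-bottom (2 + w′)) (c-right (2 + h′))))

  area : ℕ
  area = (2 + h′) * (2 + w′)

  ∑∑ : (ℕ → ℕ → ℕ) → ℕ
  ∑∑ f = ∑ (2 + h′) (λ i → ∑ (2 + w′) (f i))

  first last : ℕ → ℕ → ℕ
  first i j = ind ((i ≡ᵇ 0) ∧ (j ≡ᵇ 0))
  last  i j = ind (diag i j ∧ ((i ≡ᵇ suc h′) ∧ (j ≡ᵇ suc w′)))

  -- Each cell is filled or on a diagonal, and both only at a refilled corner. The top left corner
  -- is always on a diagonal, the bottom right one only in case `diag h′ w′`, whence the extra
  -- condition in `last`.
  cell-count : ∀ i j → ind (pattern′ i j) + ind (diag i j) ≡ 1 + (first i j + last i j)
  cell-count zero zero = refl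
  cell-count zero (suc j) with diag 0 (suc j)
  ... | true  = refl
  ... | false = refl
  cell-count (suc i) j with diag (suc i) j | (i ≡ᵇ h′) ∧ (j ≡ᵇ suc w′)
  ... | true  | true  = refl
  ... | true  | false = refl
  ... | false | true  = refl
  ... | false | false = refl

  first-total : ∑∑ first ≡ 1
  first-total = cong suc (cong₂ _+_ (∑-zero (suc w′) (λ _ _ → refl))
    (∑-zero (suc h′) (λ i _ → ∑-zero (2 + w′) (λ _ _ → refl))))

  last-total : ∑∑ last ≡ ind (diag h′ w′)
  last-total = trans (∑-last (suc h′) (λ i → ∑ (2 + w′) (last i))) (cong₂ _+_
    (∑-zero (suc h′) (λ i i<h → ∑-zero (2 + w′) (λ j _ → trans
      (cong (λ b → ind (diag i j ∧ (b ∧ (j ≡ᵇ suc w′)))) (<⇒≡ᵇ-false i<h)) (cong ind (∧-zeroʳ (diag i j))))))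
    (trans (∑-last (suc w′) (last (suc h′))) (cong₂ _+_
      (∑-zero (suc w′) (λ j j<w → trans
        (cong (λ b → ind (diag (suc h′) j ∧ ((h′ ≡ᵇ h′) ∧ b))) (<⇒≡ᵇ-false j<w))
        (trans (cong (λ b → ind (diag (suc h′) j ∧ b)) (∧-zeroʳ (h′ ≡ᵇ h′))) (cong ind (∧-zeroʳ (diag (suc h′) j))))))
      (trans (cong₂ (λ b b′ → ind (diag h′ w′ ∧ (b ∧ b′))) (≡ᵇ-refl h′) (≡ᵇ-refl w′)) (lemma (diag h′ w′))))))
    where
    lemma : ∀ b → ind (b ∧ true) ≡ ind b
    lemma true  = refl
    lemma false = refl

  count+diag : filledCount word + ∑∑ (λ i j → ind (diag i j)) ≡ area + (1 + ind (diag h′ w′))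
  count+diag = begin
    filledCount word + ∑∑ (λ i j → ind (diag i j))
      ≡⟨ cong (_+ ∑∑ (λ i j → ind (diag i j))) word-count ⟩
    ∑∑ (λ i j → ind (pattern′ i j)) + ∑∑ (λ i j → ind (diag i j))
      ≡⟨ sym (∑∑-+ (2 + h′) (2 + w′) (λ i j → ind (pattern′ i j)) (λ i j → ind (diag i j))) ⟩
    ∑∑ (λ i j → ind (pattern′ i j) + ind (diag i j))
      ≡⟨ ∑-cong (2 + h′) (λ i _ → ∑-cong (2 + w′) (λ j _ → cell-count i j)) ⟩
    ∑∑ (λ i j → 1 + (first i j + last i j))
      ≡⟨ trans (∑∑-+ (2 + h′) (2 + w′) (λ _ _ → 1) (λ i j → first i j + last i j)) (cong (∑∑ (λ _ _ → 1) +_) (∑∑-+ (2 + h′) (2 + w′) first last)) ⟩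
    ∑∑ (λ _ _ → 1) + (∑∑ first + ∑∑ last)
      ≡⟨ cong₂ _+_ (trans (∑-cong (2 + h′) (λ _ _ → trans (∑-const (2 + w′) 1) (*-identityʳ (2 + w′)))) (∑-const (2 + h′) (2 + w′)))
           (cong₂ _+_ first-total last-total) ⟩
    area + (1 + ind (diag h′ w′)) ∎
    where open ≡-Reasoning

diagonals : ℕ → ℕ → ℕ
diagonals h w = ∑ h (λ i → ∑ w (λ j → ind (diag i j)))

diagonals-sym : ∀ h w → diagonals h w ≡ diagonals w h
diagonals-sym h w = trans (∑-cong h (λ i _ → ∑-cong w (λ j _ → cong ind (diag-sym i j)))) (∑-swap h w _)

-- Three consecutive rows contain exactly one diagonal cell in each column.
diagonals-period : ∀ h w → diagonals (3 + h) w ≡ w + diagonals h w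
diagonals-period h w = trans (regroup (r 0) (r 1) (r 2) _) (cong₂ _+_
  (trans (cong (_+ r 2) (sym (∑-+ w (λ j → ind (diag 0 j)) (λ j → ind (diag 1 j)))))
    (trans (sym (∑-+ w (λ j → ind (diag 0 j) + ind (diag 1 j)) (λ j → ind (diag 2 j)))) (trans (∑-cong w (λ j _ → three j)) (trans (∑-const w 1) (*-identityʳ w)))))
  (∑-cong h (λ i _ → ∑-cong w (λ j _ → cong ind (diag-period i j)))))
  where
  r : ℕ → ℕ
  r i = ∑ w (λ j → ind (diag i j))
  regroup : ∀ a b c d → a + (b + (c + d)) ≡ a + b + c + d
  regroup = solve-∀
  three : ∀ j → ind (diag 0 j) + ind (diag 1 j) + ind (diag 2 j) ≡ 1
  three 0 = refl
  three 1 = refl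
  three (suc (suc j)) = go j
    where
    go : ∀ j → ind (third (2 + j)) + ind (third (1 + j)) + ind (third j) ≡ 1
    go 0 = refl
    go 1 = refl
    go 2 = refl
    go (suc (suc (suc j))) = go j

-- By how much three times the number of diagonal cells exceeds the area. Three added rows or
-- columns do not change it, since a third of the added cells is diagonal.
rest : ℕ → ℕ → ℕ
rest (suc (suc (suc h))) w = rest h w
rest h (suc (suc (suc w))) = rest h w
rest 1 1 = 2
rest 1 2 = 1
rest 2 1 = 1
rest 2 2 = 2
rest _ _ = 0

rest-period : ∀ h w → rest h (3 + w) ≡ rest h w
rest-period 0 w = refl
rest-period 1 w = refl
rest-period 2 w = refl
rest-period (suc (suc (suc h))) w = rest-period h w

3*diagonals : ∀ h w → 3 * diagonals h w ≡ h * w + rest h w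
3*diagonals (suc (suc (suc h))) w = begin
  3 * diagonals (3 + h) w    ≡⟨ cong (3 *_) (diagonals-period h w) ⟩
  3 * (w + diagonals h w)    ≡⟨ *-distribˡ-+ 3 w _ ⟩
  3 * w + 3 * diagonals h w  ≡⟨ cong (3 * w +_) (3*diagonals h w) ⟩
  3 * w + (h * w + rest h w) ≡⟨ lemma h w (rest h w) ⟩
  (3 + h) * w + rest h w     ∎
  where
  open ≡-Reasoning
  lemma : ∀ h w r → 3 * w + (h * w + r) ≡ (3 + h) * w + r
  lemma = solve-∀
3*diagonals h (suc (suc (suc w))) = begin
  3 * diagonals h (3 + w)    ≡⟨ cong (3 *_) (trans (diagonals-sym h (3 + w)) (trans (diagonals-period w h) (cong (h +_) (diagonals-sym w h)))) ⟩
  3 * (h + diagonals h w)    ≡⟨ *-distribˡ-+ 3 h _ ⟩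
  3 * h + 3 * diagonals h w  ≡⟨ cong (3 * h +_) (3*diagonals h w) ⟩
  3 * h + (h * w + rest h w) ≡⟨ lemma h w (rest h w) ⟩
  h * (3 + w) + rest h w     ≡⟨ cong (h * (3 + w) +_) (sym (rest-period h w)) ⟩
  h * (3 + w) + rest h (3 + w) ∎
  where
  open ≡-Reasoning
  lemma : ∀ h w r → 3 * h + (h * w + r) ≡ h * (3 + w) + r
  lemma = solve-∀
3*diagonals 0 0 = refl
3*diagonals 0 1 = refl
3*diagonals 0 2 = refl
3*diagonals 1 0 = refl
3*diagonals 1 1 = refl
3*diagonals 1 2 = refl
3*diagonals 2 0 = refl
3*diagonals 2 1 = refl
3*diagonals 2 2 = refl

diagonal-count : ∀ h′ w′ → let h = 2 + h′; w = 2 + w′ in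
  3 * filledCount (Diagonal.word h′ w′) + rest h w ≡ 2 * (h * w) + (3 + 3 * ind (diag h w))
diagonal-count h′ w′ = +-cancelˡ-≡ (h * w) _ _ (begin
  h * w + (3 * N + rest h w)       ≡⟨ l₁ (h * w) N (rest h w) ⟩
  3 * N + (h * w + rest h w)       ≡⟨ cong (3 * N +_) (sym (3*diagonals h w)) ⟩
  3 * N + 3 * diagonals h w        ≡⟨ sym (*-distribˡ-+ 3 N _) ⟩
  3 * (N + diagonals h w)          ≡⟨ cong (3 *_) (Diagonal.count+diag h′ w′) ⟩
  3 * (h * w + (1 + ind (diag h′ w′))) ≡⟨ l₂ (h * w) (ind (diag h′ w′)) ⟩
  h * w + (2 * (h * w) + (3 + 3 * ind (diag h′ w′))) ∎)
  where
  open ≡-Reasoning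
  h w N : ℕ
  h = 2 + h′
  w = 2 + w′
  N = filledCount (Diagonal.word h′ w′)
  l₁ : ∀ a n r → a + (3 * n + r) ≡ 3 * n + (a + r)
  l₁ = solve-∀
  l₂ : ∀ a d → 3 * (a + (1 + d)) ≡ a + (2 * a + (3 + 3 * d))
  l₂ = solve-∀

-- Words of width at most three

+-mono₄-≤ : ∀ {a b c d a′ b′ c′ d′} → a ≤ a′ → b ≤ b′ → c ≤ c′ → d ≤ d′ → a + b + c + d ≤ a′ + b′ + c′ + d′
+-mono₄-≤ p q r s = +-mono-≤ (+-mono-≤ (+-mono-≤ p q) r) s

-- The closed cycle along the border of a (3 + n) × 3 word: every filled cell has degree two, and
-- the middle column is empty except at its two ends.
module Ring (n : ℕ) where
  end : ℕ → Bool
  end i = (i ≡ᵇ 0) ∨ (i ≡ᵇ 2 + n)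

  open Pattern (3 + n) 3 (λ i j → not (j ≡ᵇ 1) ∨ end i) public

  end-cases : ∀ i → end i ≡ true → i ≡ 0 ⊎ i ≡ 2 + n
  end-cases zero    _  = inj₁ refl
  end-cases (suc i) eq = inj₂ (≡ᵇ-true (suc i) (2 + n) eq)

  word-inW2 : InW2 word
  word-inW2 = inW2 deg
    where
    right₀ : ∀ i → end i ≡ false → c (suc i) 2 ≤ 0
    right₀ i e = ≤-trans (c≤ i 1) (≤-reflexive (cong ind e))
    deg : ∀ i j → i < 3 + n → j < 3 → (not (j ≡ᵇ 1) ∨ end i) ≡ true →
          c i (suc j) + c (2 + i) (suc j) + c (suc i) j + c (suc i) (2 + j) ≤ 2
    deg i 0 i<h _ _ with end i in e
    ... | false = +-mono₄-≤ (c≤1 i 1) (c≤1 (2 + i) 1) (≤-reflexive (c-left (suc i))) (right₀ i e)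
    ... | true with end-cases i e
    ...   | inj₁ refl = +-mono₄-≤ (z≤n {0}) (c≤1 2 1) (≤-reflexive (c-left 1)) (c≤1 1 2)
    ...   | inj₂ refl = +-mono₄-≤ (c≤1 (2 + n) 1) (≤-reflexive (c-bottom 1)) (≤-reflexive (c-left (3 + n))) (c≤1 (3 + n) 2)
    deg i 1 i<h _ eq with end-cases i eq
    ... | inj₁ refl = +-mono₄-≤ (z≤n {0}) (c≤ 1 1) (c≤1 1 1) (c≤1 1 3)
    ... | inj₂ refl = +-mono₄-≤ (≤-trans (c≤ (suc n) 1) (≤-reflexive (cong ind (<⇒≡ᵇ-false (n<1+n (suc n))))))
                                (≤-reflexive (c-bottom 2)) (c≤1 (3 + n) 1) (c≤1 (3 + n) 3)
    deg i 2 i<h _ _ with end i in e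
    ... | false = +-mono₄-≤ (c≤1 i 3) (c≤1 (2 + i) 3) (right₀ i e) (≤-reflexive (c-right (suc i)))
    ... | true with end-cases i e
    ...   | inj₁ refl = +-mono₄-≤ (z≤n {0}) (c≤1 2 3) (c≤1 1 2) (≤-reflexive (c-right 1))
    ...   | inj₂ refl = +-mono₄-≤ (c≤1 (2 + n) 3) (≤-reflexive (c-bottom 3)) (c≤1 (3 + n) 2) (≤-reflexive (c-right (3 + n)))
    deg i (suc (suc (suc j))) _ (s≤s (s≤s (s≤s ()))) _

  row : ℕ → ℕ
  row i = 1 + (ind (end i) + 1)

  word-total : filledCount word ≡ 2 * n + 8
  word-total = begin
    filledCount word
      ≡⟨ word-count ⟩
    ∑ (3 + n) row
      ≡⟨ cong (3 +_) (∑-last (suc n) (λ i → row (suc i))) ⟩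
    3 + (∑ (suc n) (λ i → row (suc i)) + row (2 + n))
      ≡⟨ cong₂ (λ a b → 3 + (a + (1 + (ind b + 1))))
           (trans (∑-cong (suc n) (λ i i<n → cong (λ b → 1 + (ind b + 1)) (<⇒≡ᵇ-false i<n))) (∑-const (suc n) 2))
           (≡ᵇ-refl n) ⟩
    3 + (suc n * 2 + 3)
      ≡⟨ lemma n ⟩
    2 * n + 8 ∎
    where
    open ≡-Reasoning
    lemma : ∀ n → 3 + (suc n * 2 + 3) ≡ 2 * n + 8
    lemma = solve-∀

-- A winding path: full rows alternate with single cells, which lie in turn on the left and on the
-- right. This gives three cells per two rows.
zigzag : ℕ → ℕ → Bool
zigzag 0 j = true
zigzag 1 j = j ≡ᵇ 0
zigzag 2 j = true
zigzag 3 j = not (j ≡ᵇ 0)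
zigzag (suc (suc (suc (suc i)))) j = zigzag i j

module Zigzag (h : ℕ) where
  open Pattern h 2 zigzag public

  deg₀ : ∀ i → zigzag (suc i) 0 ≡ true → ind (zigzag i 0) + ind (zigzag (2 + i) 0) + 0 + ind (zigzag (suc i) 1) ≤ 2
  deg₀ 0 _ = ≤-refl
  deg₀ 1 _ = ≤-refl
  deg₀ 2 ()
  deg₀ 3 _ = ≤-refl
  deg₀ (suc (suc (suc (suc i)))) = deg₀ i

  deg₁ : ∀ i → zigzag (suc i) 1 ≡ true → ind (zigzag i 1) + ind (zigzag (2 + i) 1) + ind (zigzag (suc i) 0) + 0 ≤ 2
  deg₁ 0 ()
  deg₁ 1 _ = ≤-refl
  deg₁ 2 _ = ≤-refl
  deg₁ 3 _ = ≤-refl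
  deg₁ (suc (suc (suc (suc i)))) = deg₁ i

  word-inW2 : InW2 word
  word-inW2 = inW2 deg
    where
    deg : ∀ i j → i < h → j < 2 → zigzag i j ≡ true →
          c i (suc j) + c (2 + i) (suc j) + c (suc i) j + c (suc i) (2 + j) ≤ 2
    deg 0 0 _ _ _ = +-mono₄-≤ (z≤n {0}) (c≤1 2 1) (≤-reflexive (c-left 1)) (c≤1 1 2)
    deg 0 1 _ _ _ = +-mono₄-≤ (z≤n {0}) (c≤1 2 2) (c≤1 1 1) (≤-reflexive (c-right 1))
    deg (suc i) 0 _ _ eq = ≤-trans (+-mono₄-≤ (c≤ i 0) (c≤ (2 + i) 0) (≤-reflexive (c-left (2 + i))) (c≤ (suc i) 1)) (deg₀ i eq)
    deg (suc i) 1 _ _ eq = ≤-trans (+-mono₄-≤ (c≤ i 1) (c≤ (2 + i) 1) (c≤ (suc i) 0) (≤-reflexive (c-right (2 + i)))) (deg₁ i eq)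
    deg i (suc (suc j)) _ (s≤s (s≤s ())) _

zigzagTotal : ℕ → ℕ
zigzagTotal 0 = 0
zigzagTotal 1 = 2
zigzagTotal (suc (suc h)) = zigzagTotal h + 3

zigzag-total : ∀ h → filledCount (Zigzag.word h) ≡ zigzagTotal h
zigzag-total h = trans (Zigzag.word-count h) (go h)
  where
  go : ∀ h → ∑ h (λ i → ∑ 2 (λ j → ind (zigzag i j))) ≡ zigzagTotal h
  go 0 = refl
  go 1 = refl
  go 2 = refl
  go 3 = refl
  go (suc (suc (suc (suc h)))) = trans (cong (6 +_) (go h)) (lemma (zigzagTotal h))
    where
    lemma : ∀ z → 6 + z ≡ z + 3 + 3
    lemma = solve-∀

module Column (h : ℕ) where
  open Pattern h 1 (λ _ _ → true) public

  word-inW2 : InW2 word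
  word-inW2 = inW2 deg
    where
    deg : ∀ i j → i < h → j < 1 → true ≡ true →
          c i (suc j) + c (2 + i) (suc j) + c (suc i) j + c (suc i) (2 + j) ≤ 2
    deg i 0 _ _ _ = +-mono₄-≤ (c≤1 i 1) (c≤1 (2 + i) 1) (≤-reflexive (c-left (suc i))) (≤-reflexive (c-right (suc i)))
    deg i (suc j) _ (s≤s ()) _

  word-total : filledCount word ≡ h
  word-total = trans word-count (trans (∑-const h 1) (*-identityʳ h))

module Square where
  open Pattern 2 2 (λ _ _ → true) public

  word-inW2 : InW2 word
  word-inW2 = inW2 deg
    where
    deg : ∀ i j → i < 2 → j < 2 → true ≡ true →
          c i (suc j) + c (2 + i) (suc j) + c (suc i) j + c (suc i) (2 + j) ≤ 2
    deg 0 0 _ _ _ = ≤-refl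
    deg 0 1 _ _ _ = ≤-refl
    deg 1 0 _ _ _ = ≤-refl
    deg 1 1 _ _ _ = ≤-refl
    deg (suc (suc i)) j (s≤s (s≤s ())) _ _
    deg i (suc (suc j)) _ (s≤s (s≤s ())) _

-- Grids of width two to five

count : ∀ {d} → Bits d → ℕ
count []       = 0
count (b ∷ bs) = ind b + count bs

rowBits : ∀ d → (ℕ → Cell) → Bits d
rowBits zero    f = []
rowBits (suc d) f = bit (f 0) ∷ rowBits d (λ j → f (suc j))

count-rowBits : ∀ d f → ∑ d (λ j → fl (f j)) ≡ count (rowBits d f)
count-rowBits zero    f = refl
count-rowBits (suc d) f = cong₂ _+_ (sym (ind-bit (f 0))) (count-rowBits d _)

rowBits-out : ∀ d f → (∀ j → f j ≡ out) → rowBits d f ≡ blank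
rowBits-out zero    f h = refl
rowBits-out (suc d) f h = cong₂ _∷_ (cong bit (h 0)) (rowBits-out d _ (λ j → h (suc j)))

hd-rowBits : ∀ d f → f d ≡ out → hd (rowBits d f) ≡ bit (f 0)
hd-rowBits zero    f h = sym (cong bit h)
hd-rowBits (suc d) f h = refl

legal-rowBits : ∀ d (u c l : ℕ → Cell) → c (suc d) ≡ out →
  (∀ j → j < d → c (suc j) ≡ full → fl (u (suc j)) + fl (l (suc j)) + fl (c j) + fl (c (2 + j)) ≤ 2) →
  Legal (bit (c 0)) (rowBits d (λ j → u (suc j))) (rowBits d (λ j → c (suc j))) (rowBits d (λ j → l (suc j)))
legal-rowBits zero    u c l end deg = tt
legal-rowBits (suc d) u c l end deg rewrite hd-rowBits d (λ j → c (2 + j)) end =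
  fits-bit (c 1) (c 0) (c 2) (u 1) (l 1) (λ eq → subst (_≤ 2)
    (lemma (fl (u 1)) (fl (l 1)) (fl (c 0)) (fl (c 2))) (deg 0 (s≤s z≤n) eq)) ,
  legal-rowBits d (λ j → u (suc j)) (λ j → c (suc j)) (λ j → l (suc j)) end (λ j j<d → deg (suc j) (s≤s j<d))
  where
  lemma : ∀ a b c d → a + b + c + d ≡ c + d + a + b
  lemma = solve-∀

-- The word is read row by row, and a row is worth the number of its filled cells wherever it
-- stands. So k is fixed at 3, where `next` is stationary, and tables of different lengths become
-- comparable.
module Narrow (d : ℕ) where
  open Chain {d} (λ _ _ _ b _ → count b) public

  filled-≤ : ∀ {h} (G : Grid h d) B → (∀ b → value 3 h blank b ≤ B) → filled G ≤ B
  filled-≤ {h} G B bound = begin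
    filled G
      ≡⟨ ∑-cong h (λ i _ → count-rowBits d _) ⟩
    ∑ h (λ i → count (row (suc i)))
      ≤⟨ value-upper h 3 row _ (λ _ → 0) legal (λ i m _ → m≤m+n _ 0) ⟩
    value 3 h (row 0) (row 1) + ∑ h (λ _ → 0)
      ≡⟨ cong₂ (λ a s → value 3 h a (row 1) + s) (rowBits-out d _ (λ j → top G (suc j))) (∑-zero h (λ _ _ → refl)) ⟩
    value 3 h blank (row 1) + 0
      ≡⟨ +-identityʳ _ ⟩
    value 3 h blank (row 1)
      ≤⟨ bound (row 1) ⟩
    B ∎
    where
    open ≤-Reasoning
    row : ℕ → Bits d
    row i = rowBits d (λ j → at G i (suc j))
    legal : ∀ i → i < h → Legal false (row i) (row (1 + i)) (row (2 + i))
    legal i i<h = subst (λ c → Legal (bit c) (row i) (row (1 + i)) (row (2 + i))) (left G (suc i))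
      (legal-rowBits d (at G i) (at G (suc i)) (at G (2 + i)) (right G (suc i)) (λ j j<d → degree≤2 G i j i<h j<d))

  value-shift : ∀ n n′ c → (∀ a b → value 3 n a b ≤ value 3 n′ a b + c) →
                ∀ m a b → value 3 (m + n) a b ≤ value 3 (m + n′) a b + c
  value-shift n n′ c h zero    = h
  value-shift n n′ c h (suc m) = value-step 3 c (λ _ _ _ → refl) (value-shift n n′ c h m)

-- The maxima of the heights 4 + n (width 4) and 5 + n (width 5).
cap₄ cap₅ : ℕ → ℕ
cap₄ 0 = 12
cap₄ 1 = 14
cap₄ 2 = 17
cap₄ (suc (suc (suc n))) = cap₄ n + 8
cap₅ 0 = 18
cap₅ 1 = 21
cap₅ 2 = 24
cap₅ (suc (suc (suc n))) = cap₅ n + 10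

module N₂ where
  open Narrow 2
  -- Two more rows add at most three cells, as the tables of 5 and 3 rows show; heights 3 and 4
  -- start the induction.
  bound : ∀ n b → value 3 (n + 3) blank b ≤ zigzagTotal (3 + n)
  bound 0 = value-blank-≤ 3 3 5 refl
  bound 1 = value-blank-≤ 3 4 6 refl
  bound (suc (suc n)) b = ≤-trans
    (subst (λ k → value 3 k blank b ≤ value 3 (n + 3) blank b + 3) (trans (+-suc n 4) (cong suc (+-suc n 3)))
      (value-shift 5 3 3 (value-≤ 3 5 3 3 refl) n blank b))
    (+-monoˡ-≤ 3 (bound n b))

module N₃ where
  open Narrow 3
  -- Three more rows add at most six cells. The tables compared are those of 8 and 5 rows, so the
  -- heights 3 to 7 are evaluated directly.
  bound : ∀ n b → value 3 (n + 3) blank b ≤ 2 * n + 8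
  bound 0 = value-blank-≤ 3 3 8 refl
  bound 1 = value-blank-≤ 3 4 10 refl
  bound 2 = value-blank-≤ 3 5 12 refl
  bound 3 = value-blank-≤ 3 6 14 refl
  bound 4 = value-blank-≤ 3 7 16 refl
  bound (suc (suc (suc (suc (suc n))))) b = ≤-trans
    (subst₂ (λ k k′ → value 3 k blank b ≤ value 3 k′ blank b + 6) (l₁ n) (l₂ n)
      (value-shift 8 5 6 (value-≤ 3 8 5 6 refl) n blank b))
    (≤-trans (+-monoˡ-≤ 6 (bound (suc (suc n)) b)) (≤-reflexive (l₃ n)))
    where
    l₁ : ∀ n → n + 8 ≡ 5 + n + 3
    l₁ = solve-∀
    l₂ : ∀ n → n + 5 ≡ 2 + n + 3
    l₂ = solve-∀
    l₃ : ∀ n → 2 * (2 + n) + 8 + 6 ≡ 2 * (5 + n) + 8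
    l₃ = solve-∀

module N₄ where
  open Narrow 4
  -- Three more rows add at most eight of their twelve cells, the average density 2/3; the tables of
  -- 6 and 3 rows show it.
  bound : ∀ n b → value 3 (n + 4) blank b ≤ cap₄ n
  bound 0 = value-blank-≤ 3 4 12 refl
  bound 1 = value-blank-≤ 3 5 14 refl
  bound 2 = value-blank-≤ 3 6 17 refl
  bound (suc (suc (suc n))) b = ≤-trans
    (subst₂ (λ k k′ → value 3 k blank b ≤ value 3 k′ blank b + 8) (l₁ n) (l₂ n)
      (value-shift 6 3 8 (value-≤ 3 6 3 8 refl) (suc n) blank b))
    (+-monoˡ-≤ 8 (bound n b))
    where
    l₁ : ∀ n → suc n + 6 ≡ 3 + n + 4
    l₁ = solve-∀
    l₂ : ∀ n → suc n + 3 ≡ n + 4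
    l₂ = solve-∀

module N₅ where
  open Narrow 5
  bound : ∀ n b → value 3 (n + 5) blank b ≤ cap₅ n
  bound 0 = value-blank-≤ 3 5 18 refl
  bound 1 = value-blank-≤ 3 6 21 refl
  bound 2 = value-blank-≤ 3 7 24 refl
  bound (suc (suc (suc n))) b = ≤-trans
    (subst₂ (λ k k′ → value 3 k blank b ≤ value 3 k′ blank b + 10) (l₁ n) (l₂ n)
      (value-shift 6 3 10 (value-≤ 3 6 3 10 refl) (2 + n) blank b))
    (+-monoˡ-≤ 10 (bound n b))
    where
    l₁ : ∀ n → 2 + n + 6 ≡ 3 + n + 5
    l₁ = solve-∀
    l₂ : ∀ n → 2 + n + 3 ≡ n + 5
    l₂ = solve-∀

-- From counts to excesses

/-cross : ∀ a b c d → a * suc d ≡ b * suc c → (ℤ.+ a) / suc c ≡ (ℤ.+ b) / suc d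
/-cross a b c d eq = ℚₚ.fromℚᵘ-cong {mkℚᵘ (ℤ.+ a) c} {mkℚᵘ (ℤ.+ b) d} (*≡*
  (trans (sym (ℤₚ.pos-* a (suc d))) (trans (cong ℤ.+_ eq) (ℤₚ.pos-* b (suc c)))))

-- Passing to unnormalised fractions turns the equation into a cross multiplication of natural
-- numbers.
/-sum : ∀ a b n c d e → (a * suc d + b * suc c) * suc e ≡ n * (suc c * suc d) →
  (ℤ.+ a) / suc c +ℚ (ℤ.+ b) / suc d ≡ (ℤ.+ n) / suc e
/-sum a b n c d e eq = ℚₚ.toℚᵘ-injective
  (ℚᵘₚ.≃-trans (ℚₚ.toℚᵘ-homo-+ ((ℤ.+ a) / suc c) ((ℤ.+ b) / suc d))
  (ℚᵘₚ.≃-trans (ℚᵘₚ.+-cong (ℚₚ.toℚᵘ-fromℚᵘ (mkℚᵘ (ℤ.+ a) c)) (ℚₚ.toℚᵘ-fromℚᵘ (mkℚᵘ (ℤ.+ b) d)))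
  (ℚᵘₚ.≃-trans (*≡* cross) (ℚᵘₚ.≃-sym (ℚₚ.toℚᵘ-fromℚᵘ (mkℚᵘ (ℤ.+ n) e))))))
  where
  open ≡-Reasoning
  cross : (ℤ.+ a ℤ.* ℤ.+ suc d ℤ.+ ℤ.+ b ℤ.* ℤ.+ suc c) ℤ.* ℤ.+ suc e ≡ ℤ.+ n ℤ.* ℤ.+ (suc c * suc d)
  cross = begin
    (ℤ.+ a ℤ.* ℤ.+ suc d ℤ.+ ℤ.+ b ℤ.* ℤ.+ suc c) ℤ.* ℤ.+ suc e
      ≡⟨ cong (ℤ._* ℤ.+ suc e) (cong₂ ℤ._+_ (sym (ℤₚ.pos-* a (suc d))) (sym (ℤₚ.pos-* b (suc c)))) ⟩
    ℤ.+ (a * suc d + b * suc c) ℤ.* ℤ.+ suc e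
      ≡⟨ sym (ℤₚ.pos-* (a * suc d + b * suc c) (suc e)) ⟩
    ℤ.+ ((a * suc d + b * suc c) * suc e)
      ≡⟨ trans (cong ℤ.+_ eq) (ℤₚ.pos-* n (suc c * suc d)) ⟩
    ℤ.+ n ℤ.* ℤ.+ (suc c * suc d) ∎

excess-≡ : ∀ N a k → 3 * N ≡ a + k → (ℤ.+ N) / 1 - (ℤ.+ a) / 3 ≡ (ℤ.+ k) / 3
excess-≡ N a k eq = begin
  (ℤ.+ N) / 1 - (ℤ.+ a) / 3
    ≡⟨ cong (_- (ℤ.+ a) / 3) (sym (/-sum k a N 2 2 0 (trans (l₁ k a) (trans (cong (3 *_) (sym eq)) (l₂ N))))) ⟩
  ((ℤ.+ k) / 3 +ℚ (ℤ.+ a) / 3) - (ℤ.+ a) / 3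
    ≡⟨ ℚₚ.+-assoc ((ℤ.+ k) / 3) ((ℤ.+ a) / 3) (- ((ℤ.+ a) / 3)) ⟩
  (ℤ.+ k) / 3 +ℚ ((ℤ.+ a) / 3 - (ℤ.+ a) / 3)
    ≡⟨ cong ((ℤ.+ k) / 3 +ℚ_) (ℚₚ.+-inverseʳ ((ℤ.+ a) / 3)) ⟩
  (ℤ.+ k) / 3 +ℚ 0ℚ
    ≡⟨ ℚₚ.+-identityʳ _ ⟩
  (ℤ.+ k) / 3 ∎
  where
  open ≡-Reasoning
  l₁ : ∀ k a → (k * 3 + a * 3) * 1 ≡ 3 * (a + k)
  l₁ = solve-∀
  l₂ : ∀ N → 3 * (3 * N) ≡ N * (3 * 3)
  l₂ = solve-∀

/1-mono : ∀ {m n} → m ≤ n → (ℤ.+ m) / 1 ≤ℚ (ℤ.+ n) / 1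
/1-mono {m} {n} m≤n = ℚₚ.toℚᵘ-cancel-≤
  (ℚᵘₚ.≤-trans (ℚᵘₚ.≤-reflexive (ℚₚ.toℚᵘ-fromℚᵘ (mkℚᵘ (ℤ.+ m) 0)))
  (ℚᵘₚ.≤-trans (*≤* (ℤₚ.*-monoʳ-≤-nonNeg (ℤ.+ 1) (ℤ.+≤+ m≤n)))
               (ℚᵘₚ.≤-reflexive (ℚᵘₚ.≃-sym (ℚₚ.toℚᵘ-fromℚᵘ (mkℚᵘ (ℤ.+ n) 0))))))

isEmax : ∀ {h w} N k (W : Word h w) → InW2 W → filledCount W ≡ N →
  (∀ (G : Grid h w) → filled G ≤ N) → 3 * N ≡ 2 * h * w + k → IsEmax h w ((ℤ.+ k) / 3)
isEmax {h} {w} N k W w2 refl upper eq =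
  (W , w2 , excess-≡ N (2 * h * w) k eq) ,
  λ W′ w2′ → subst (excess W′ ≤ℚ_) (excess-≡ N (2 * h * w) k eq)
    (ℚₚ.+-monoˡ-≤ (- ((ℤ.+ (2 * h * w)) / 3))
      (/1-mono (subst (_≤ N) (sym (filledCount-wordAt W′)) (upper (wordGrid W′ w2′)))))

-- The formula in terms of residues modulo three

third-gain : ℕ → ℕ → ℕ
third-gain h w = (3 + 3 * ind (diag h w)) ∸ rest h w

mod3 : ∀ {A : Set} (f : ℕ → A) → (∀ n → f (3 + n) ≡ f n) → ∀ n → f n ≡ f (n % 3)
mod3 f p 0 = refl
mod3 f p 1 = refl
mod3 f p 2 = refl
mod3 f p (suc (suc (suc n))) = trans (p n) (mod3 f p n)

diag-mod3 : ∀ h w → diag h w ≡ diag (h % 3) (w % 3)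
diag-mod3 h w = trans (mod3 (λ h → diag h w) (λ n → diag-period n w) h)
  (mod3 (diag (h % 3)) (λ n → trans (diag-sym (h % 3) (3 + n)) (trans (diag-period n (h % 3)) (diag-sym n (h % 3)))) w)

rest-mod3 : ∀ h w → rest h w ≡ rest (h % 3) (w % 3)
rest-mod3 h w = trans (mod3 (λ h → rest h w) (λ _ → refl) h) (mod3 (rest (h % 3)) (rest-period (h % 3)) w)

slack-mod3 : ∀ n → slack n ≡ slack (n % 3)
slack-mod3 = mod3 slack (λ _ → refl)

residues : (P : ℕ → ℕ → Set) → P 0 0 → P 0 1 → P 0 2 → P 1 0 → P 1 1 → P 1 2 → P 2 0 → P 2 1 → P 2 2 →
           ∀ h w → P (h % 3) (w % 3)
residues P p₀₀ p₀₁ p₀₂ p₁₀ p₁₁ p₁₂ p₂₀ p₂₁ p₂₂ h w = go (h % 3) (w % 3) (m%n<n h 3) (m%n<n w 3)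
  where
  go : ∀ r s → r < 3 → s < 3 → P r s
  go 0 0 _ _ = p₀₀
  go 0 1 _ _ = p₀₁
  go 0 2 _ _ = p₀₂
  go 1 0 _ _ = p₁₀
  go 1 1 _ _ = p₁₁
  go 1 2 _ _ = p₁₂
  go 2 0 _ _ = p₂₀
  go 2 1 _ _ = p₂₁
  go 2 2 _ _ = p₂₂
  go (suc (suc (suc r))) s (s≤s (s≤s (s≤s ()))) _
  go 0 (suc (suc (suc s))) _ (s≤s (s≤s (s≤s ())))
  go 1 (suc (suc (suc s))) _ (s≤s (s≤s (s≤s ())))
  go 2 (suc (suc (suc s))) _ (s≤s (s≤s (s≤s ())))

rest≤3 : ∀ h w → rest h w ≤ 3
rest≤3 h w = subst (_≤ 3) (sym (rest-mod3 h w))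
  (residues (λ r s → rest r s ≤ 3) z≤n z≤n z≤n z≤n (m≤m+n 2 1) (m≤m+n 1 2) z≤n (m≤m+n 1 2) (m≤m+n 2 1) h w)

-- The upper bound allows 6F - 4hw up to `slack h + slack w`, while the diagonal word reaches 6 + 6
-- · `ind (diag h w)` - 2 · `rest h w`. The two differ by at most 5, less than one filled cell.
slack-gap : ∀ h w → slack h + slack w + 2 * rest h w ≤ 11 + 6 * ind (diag h w)
slack-gap h w rewrite slack-mod3 h | slack-mod3 w | rest-mod3 h w | diag-mod3 h w =
  residues (λ r s → slack r + slack s + 2 * rest r s ≤ 11 + 6 * ind (diag r s))
    (m≤m+n 12 5) (m≤m+n 11 0) (m≤m+n 10 1) (m≤m+n 11 0) (m≤m+n 14 3) (m≤m+n 11 0) (m≤m+n 10 1) (m≤m+n 11 0) (m≤m+n 12 5) h w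

-- The tests for small widths fail, and what remains depends on residues modulo 3 only, which leaves
-- nine evaluations.
emax-wide : ∀ h w → 4 ≤ h → 4 ≤ w → emaxFormula h w ≡ (ℤ.+ third-gain h w) / 3
emax-wide h@(suc (suc (suc (suc h′)))) w@(suc (suc (suc (suc w′)))) (s≤s (s≤s (s≤s (s≤s _)))) (s≤s (s≤s (s≤s (s≤s _)))) =
  trans (trans (trans
    -- The tests for width two are false, but their evaluation is stuck on the parity of h.
    (cong (λ b → if b then e₁ else if (h % 2 ≡ᵇ 1) ∧ true ∧ false then e₂ else e₃ (h % 3) (w % 3) (h * w % 3)) (∧-zeroʳ (h % 2 ≡ᵇ 0)))
    (cong (λ b → if b then e₂ else e₃ (h % 3) (w % 3) (h * w % 3)) (∧-zeroʳ (h % 2 ≡ᵇ 1))))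
    (cong (e₃ (h % 3) (w % 3)) (%-distribˡ-* h w 3)))
  (trans (residues (λ r s → e₃ r s (r * s % 3) ≡ (ℤ.+ third-gain r s) / 3) refl refl refl refl refl refl refl refl refl h w)
    (cong₂ (λ d r → (ℤ.+ ((3 + 3 * ind d) ∸ r)) / 3) (sym (diag-mod3 h w)) (sym (rest-mod3 h w))))
  where
  e₁ e₂ : ℚ
  e₁ = (ℤ.+ (h * w)) / 12
  e₂ = (ℤ.+ (h * w)) / 12 +ℚ (ℤ.+ 1) / 2
  e₃ : ℕ → ℕ → ℕ → ℚ
  e₃ r s t = if (r ≡ᵇ 0) ∧ (s ≡ᵇ 0) then (ℤ.+ 2) / 1
    else if (r ≡ᵇ s) ∧ not (s ≡ᵇ 0) then (ℤ.+ 4) / 3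
    else if (t ≡ᵇ 0) ∧ not (r ≡ᵇ s) then (ℤ.+ 1) / 1
    else (ℤ.+ 2) / 3

module Wide (h′ w′ : ℕ) where
  h w N : ℕ
  h = 2 + h′
  w = 2 + w′
  N = filledCount (Diagonal.word h′ w′)

  isEmax-wide : 4 ≤ h → 4 ≤ w → (∀ (G : Grid h w) → filled G ≤ N) → IsEmax h w (emaxFormula h w)
  isEmax-wide 4≤h 4≤w upper = subst (IsEmax h w) (sym (emax-wide h w 4≤h 4≤w))
    (isEmax N (third-gain h w) (Diagonal.word h′ w′) (Diagonal.word-inW2 h′ w′) refl upper
      (+-cancelʳ-≡ (rest h w) _ _ (trans (diagonal-count h′ w′) (begin
        2 * (h * w) + (3 + 3 * ind (diag h w))
          ≡⟨ cong₂ _+_ (sym (*-assoc 2 h w)) (sym (m∸n+n≡m (≤-trans (rest≤3 h w) (m≤m+n 3 _)))) ⟩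
        2 * h * w + (third-gain h w + rest h w)
          ≡⟨ sym (+-assoc (2 * h * w) (third-gain h w) (rest h w)) ⟩
        2 * h * w + third-gain h w + rest h w ∎))))
    where open ≡-Reasoning

  -- `diagonal-count` determines `N`; this identifies `cap₄` and `cap₅` with the counts of the
  -- diagonal words.
  exact : ∀ {M} → 3 * M + rest h w ≡ 2 * (h * w) + (3 + 3 * ind (diag h w)) → M ≡ N
  exact eq = *-cancelˡ-≡ _ _ 3 (+-cancelʳ-≡ (rest h w) _ _ (trans eq (sym (diagonal-count h′ w′))))

  -- By `slack-gap` the bound on 6F is below 6 · (N + 1), and F is an integer.
  within : ∀ {F} → 6 * F ≤ 4 * (h * w) + (slack h + slack w) → F ≤ N
  within {F} hF = s≤s⁻¹ (*-cancelˡ-< 6 F (suc N) (+-cancelʳ-< (2 * rest h w) _ _ (begin-strict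
    6 * F + 2 * rest h w
      ≤⟨ +-monoˡ-≤ (2 * rest h w) hF ⟩
    4 * (h * w) + (slack h + slack w) + 2 * rest h w
      ≡⟨ +-assoc (4 * (h * w)) (slack h + slack w) (2 * rest h w) ⟩
    4 * (h * w) + (slack h + slack w + 2 * rest h w)
      ≤⟨ +-monoʳ-≤ (4 * (h * w)) (slack-gap h w) ⟩
    4 * (h * w) + (11 + 6 * d)
      <⟨ ≤-reflexive (l₁ (h * w) d) ⟩
    2 * (2 * (h * w) + (3 + 3 * d)) + 6
      ≡⟨ cong (λ x → 2 * x + 6) (sym (diagonal-count h′ w′)) ⟩
    2 * (3 * N + rest h w) + 6
      ≡⟨ l₂ N (rest h w) ⟩
    6 * suc N + 2 * rest h w ∎)))
    where
    open ≤-Reasoning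
    d : ℕ
    d = ind (diag h w)
    l₁ : ∀ a d → suc (4 * a + (11 + 6 * d)) ≡ 2 * (2 * a + (3 + 3 * d)) + 6
    l₁ = solve-∀
    l₂ : ∀ N r → 2 * (3 * N + r) + 6 ≡ 6 * suc N + 2 * r
    l₂ = solve-∀

-- The theorem for each width

filled≤area : ∀ {h w} (G : Grid h w) → filled G ≤ h * w
filled≤area G = ≤-trans (m≤m+n (filled G) (empties G)) (≤-reflexive (filled+empties G))

emax-1 : ∀ h → IsEmax h 1 (emaxFormula h 1)
emax-1 h = isEmax h (h * 1) (Column.word h) (Column.word-inW2 h) (Column.word-total h)
  (λ G → ≤-trans (filled≤area G) (≤-reflexive (*-identityʳ h))) (lemma h)
  where
  lemma : ∀ h → 3 * h ≡ 2 * h * 1 + h * 1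
  lemma = solve-∀

emax-2-2 : IsEmax 2 2 (emaxFormula 2 2)
emax-2-2 = isEmax 4 4 Square.word Square.word-inW2 refl filled≤area refl

even-or-odd : ∀ n → (Σ ℕ λ m → n ≡ m * 2) ⊎ (Σ ℕ λ m → n ≡ suc (m * 2))
even-or-odd 0 = inj₁ (0 , refl)
even-or-odd 1 = inj₂ (0 , refl)
even-or-odd (suc (suc n)) with even-or-odd n
... | inj₁ (m , refl) = inj₁ (suc m , refl)
... | inj₂ (m , refl) = inj₂ (suc m , refl)

filled≤zigzag : ∀ n (G : Grid (3 + n) 2) → filled G ≤ zigzagTotal (3 + n)
filled≤zigzag n G = Narrow.filled-≤ 2 G _
  (subst (λ k → ∀ b → Narrow.value 2 3 k blank b ≤ zigzagTotal (3 + n)) (+-comm n 3) (N₂.bound n))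

emax-2 : ∀ n → IsEmax (3 + n) 2 (emaxFormula (3 + n) 2)
emax-2 n with even-or-odd n
-- Odd height 3 + 2m: hw/12 + 1/2 equals (m + 3)/3.
... | inj₁ (m , refl) = subst (IsEmax (3 + m * 2) 2) (sym formula)
  (isEmax (zigzagTotal (3 + m * 2)) (m + 3) (Zigzag.word (3 + m * 2)) (Zigzag.word-inW2 (3 + m * 2))
    (zigzag-total (3 + m * 2)) (filled≤zigzag (m * 2))
    (trans (cong (3 *_) (total m)) (l₁ m)))
  where
  total : ∀ m → zigzagTotal (3 + m * 2) ≡ 5 + m * 3
  total zero    = refl
  total (suc m) = trans (cong (_+ 3) (total m)) (+-comm (5 + m * 3) 3)
  l₁ : ∀ m → 3 * (5 + m * 3) ≡ 2 * (3 + m * 2) * 2 + (m + 3)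
  l₁ = solve-∀
  l₂ : ∀ m → ((3 + m * 2) * 2 * 2 + 1 * 12) * 3 ≡ (m + 3) * (12 * 2)
  l₂ = solve-∀
  residue : (3 + m * 2) % 2 ≡ 1
  residue = [m+kn]%n≡m%n 3 m 2
  formula : emaxFormula (3 + m * 2) 2 ≡ (ℤ.+ (m + 3)) / 3
  formula rewrite residue = /-sum ((3 + m * 2) * 2) 1 (m + 3) 11 1 2 (l₂ m)
-- Even height 4 + 2m: hw/12 equals (m + 2)/3.
... | inj₂ (m , refl) = subst (IsEmax (4 + m * 2) 2) (sym formula)
  (isEmax (zigzagTotal (4 + m * 2)) (m + 2) (Zigzag.word (4 + m * 2)) (Zigzag.word-inW2 (4 + m * 2))
    (zigzag-total (4 + m * 2)) (filled≤zigzag (suc (m * 2)))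
    (trans (cong (3 *_) (total m)) (l₁ m)))
  where
  total : ∀ m → zigzagTotal (4 + m * 2) ≡ 6 + m * 3
  total zero    = refl
  total (suc m) = trans (cong (_+ 3) (total m)) (+-comm (6 + m * 3) 3)
  l₁ : ∀ m → 3 * (6 + m * 3) ≡ 2 * (4 + m * 2) * 2 + (m + 2)
  l₁ = solve-∀
  l₂ : ∀ m → (4 + m * 2) * 2 * 3 ≡ (m + 2) * 12
  l₂ = solve-∀
  residue : (4 + m * 2) % 2 ≡ 0
  residue = [m+kn]%n≡m%n 4 m 2
  formula : emaxFormula (4 + m * 2) 2 ≡ (ℤ.+ (m + 2)) / 3
  formula rewrite residue = /-cross ((4 + m * 2) * 2) (m + 2) 11 2 (l₂ m)

emax-3 : ∀ n → IsEmax (3 + n) 3 (emaxFormula (3 + n) 3)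
emax-3 n = subst (IsEmax (3 + n) 3) (sym formula)
  (isEmax (2 * n + 8) 6 (Ring.word n) (Ring.word-inW2 n) (Ring.word-total n)
    (λ G → Narrow.filled-≤ 3 G _
      (subst (λ k → ∀ b → Narrow.value 3 3 k blank b ≤ 2 * n + 8) (+-comm n 3) (N₃.bound n)))
    (lemma n))
  where
  lemma : ∀ n → 3 * (2 * n + 8) ≡ 2 * (3 + n) * 3 + 6
  lemma = solve-∀
  formula : emaxFormula (3 + n) 3 ≡ (ℤ.+ 6) / 3
  formula rewrite ∧-zeroʳ (4 ≤ᵇ 3 + n) | ∧-zeroʳ ((3 + n) % 2 ≡ᵇ 0) | ∧-zeroʳ ((3 + n) % 2 ≡ᵇ 1) = refl

emax-4 : ∀ n → IsEmax (4 + n) 4 (emaxFormula (4 + n) 4)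
emax-4 n = isEmax-wide (m≤m+n 4 n) ≤-refl (λ G → subst (filled G ≤_) (exact {cap₄ n} (total n))
  (Narrow.filled-≤ 4 G _ (subst (λ k → ∀ b → Narrow.value 4 3 k blank b ≤ cap₄ n) (+-comm n 4) (N₄.bound n))))
  where
  open Wide (2 + n) 2
  total : ∀ n → 3 * cap₄ n + rest (4 + n) 4 ≡ 2 * ((4 + n) * 4) + (3 + 3 * ind (diag (4 + n) 4))
  total 0 = refl
  total 1 = refl
  total 2 = refl
  total (suc (suc (suc n))) rewrite diag-period n 0 = trans (l₁ (cap₄ n) (rest (4 + n) 4))
    (trans (cong (λ x → 24 + x) (total n)) (l₂ n (ind (diag n 0))))
    where
    l₁ : ∀ c r → 3 * (c + 8) + r ≡ 24 + (3 * c + r)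
    l₁ = solve-∀
    l₂ : ∀ n d → 24 + (2 * ((4 + n) * 4) + (3 + 3 * d)) ≡ 2 * ((7 + n) * 4) + (3 + 3 * d)
    l₂ = solve-∀

emax-5 : ∀ n → IsEmax (5 + n) 5 (emaxFormula (5 + n) 5)
emax-5 n = isEmax-wide (m≤m+n 4 (suc n)) (m≤m+n 4 1) (λ G → subst (filled G ≤_) (exact {cap₅ n} (total n))
  (Narrow.filled-≤ 5 G _ (subst (λ k → ∀ b → Narrow.value 5 3 k blank b ≤ cap₅ n) (+-comm n 5) (N₅.bound n))))
  where
  open Wide (3 + n) 3
  total : ∀ n → 3 * cap₅ n + rest (5 + n) 5 ≡ 2 * ((5 + n) * 5) + (3 + 3 * ind (diag (5 + n) 5))
  total 0 = refl
  total 1 = refl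
  total 2 = refl
  total (suc (suc (suc n))) rewrite diag-period n 0 = trans (l₁ (cap₅ n) (rest (5 + n) 5))
    (trans (cong (λ x → 30 + x) (total n)) (l₂ n (ind (diag n 0))))
    where
    l₁ : ∀ c r → 3 * (c + 10) + r ≡ 30 + (3 * c + r)
    l₁ = solve-∀
    l₂ : ∀ n d → 30 + (2 * ((5 + n) * 5) + (3 + 3 * d)) ≡ 2 * ((8 + n) * 5) + (3 + 3 * d)
    l₂ = solve-∀

emax-6 : ∀ m n → IsEmax (6 + m) (6 + n) (emaxFormula (6 + m) (6 + n))
emax-6 m n = isEmax-wide (m≤m+n 4 (2 + m)) (m≤m+n 4 (2 + n)) (λ G → within (frame-bound G))
  where open Wide (4 + m) (4 + n)

theorem2 : (h w : ℕ) → 1 ≤ h → 1 ≤ w → w ≤ h → IsEmax h w (emaxFormula h w)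
theorem2 h 1 _ _ _ = emax-1 h
theorem2 2 2 _ _ _ = emax-2-2
theorem2 (suc (suc (suc n))) 2 _ _ _ = emax-2 n
theorem2 (suc (suc (suc n))) 3 _ _ _ = emax-3 n
theorem2 (suc (suc (suc (suc n)))) 4 _ _ _ = emax-4 n
theorem2 (suc (suc (suc (suc (suc n))))) 5 _ _ _ = emax-5 n
theorem2 (suc (suc (suc (suc (suc (suc m)))))) (suc (suc (suc (suc (suc (suc n)))))) _ _ _ = emax-6 m n
theorem2 (suc (suc (suc (suc (suc zero))))) (suc (suc (suc (suc (suc (suc n)))))) _ _ (s≤s (s≤s (s≤s (s≤s (s≤s ())))))
theorem2 1 (suc (suc w)) _ _ (s≤s ())
theorem2 2 (suc (suc (suc w))) _ _ (s≤s (s≤s ()))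
theorem2 3 (suc (suc (suc (suc w)))) _ _ (s≤s (s≤s (s≤s ())))
theorem2 4 (suc (suc (suc (suc (suc w))))) _ _ (s≤s (s≤s (s≤s (s≤s ()))))
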